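{- The integrality gap of the linear programming relaxation (LP1) (defined in the context) of the minimum latency problem is at most $10.78$; that is, for every instance, the optimal value of the minimum latency problem is at most $10.78$ times the optimal value of (LP1).
   Context: Minimum latency problem (ML): let $G=(\mathcal D\cup\{r\},E)$ be the complete graph on $N=|\mathcal D|+1$ nodes with edge weights $\{d_e\}$ forming a metric (with integer values). Find a path starting at $r$ and visiting all nodes of $\mathcal D$ that minimizes the sum over $j\in\mathcal D$ of the latency of $j$, i.e. the length of the path from $r$ to $j$. Let $T$ be an integer upper bound on the maximum latency of a node in an optimal solution; $t$ ranges over $\{1,\dots,T\}$. For $S\subseteq\mathcal D$, $\delta(S)$ is the set of edges with exactly one endpoint in $S$. (LP1) has variables $x_{j,t}\ge0$ ($j\in\mathcal D$) and $z_{e,t}\ge0$ ($e\in E$), where $x_{j,t}=0$ whenever $d_{jr}>t$: minimize $\sum_{j,t}t\,x_{j,t}$ subject to $\sum_tx_{j,t}\ge1$ for all $j$; $\sum_ed_ez_{e,t}\le t$ for all $t$; $\sum_{e\in\delta(S)}z_{e,t}\ge\sum_{t'\le t}x_{j,t'}$ for all $t$, all $S\subseteq\mathcal D$ and all $j\in S$.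
   Formalization: The variables x and z of (LP1) are taken to be rational instead of real; as the data of the linear program are integers, its optimal value is the same. -}

module Defs where

open import Algebra.Properties.CommutativeMonoid.Sum using (sum)
open import Data.Bool.Base using (if_then_else_; _xor_)
open import Data.Fin.Base using (Fin; Fin′; zero; suc; toℕ; inject; inject₁)
open import Data.Fin.Permutation using (Permutation′; _⟨$⟩ʳ_; _⟨$⟩ˡ_)
import Data.Fin.Properties as Fin
open import Data.Fin.Subset using (Subset; outside; _∈_)
import Data.Integer.Base as ℤ
open import Data.Nat.Base as ℕ using (ℕ)
import Data.Nat.Properties as ℕ
open import Data.Product.Base using (Σ; _,_; proj₁; proj₂)
open import Data.Rational.Base using (ℚ; 0ℚ; 1ℚ; _*_; _≤_; _/_)
import Data.Rational.Properties as ℚ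
open import Data.Vec.Base using (_∷_; lookup)
open import Function.Metric.Nat.Structures using (IsMetric)
open import Relation.Binary.PropositionalEquality.Core using (_≡_)
open import Relation.Nullary.Decidable.Core using (does)

∑ℕ : ∀ {n} → (Fin n → ℕ) → ℕ
∑ℕ = sum ℕ.+-0-commutativeMonoid

∑ℚ : ∀ {n} → (Fin n → ℚ) → ℚ
∑ℚ = sum ℚ.+-0-commutativeMonoid

ℕ→ℚ : ℕ → ℚ
ℕ→ℚ k = ℤ.+ k / 1

-- The nodes are Fin (suc n): the root r is zero, and 𝒟 = Fin n, with j ∈ 𝒟
-- being the node suc j.
Node : ℕ → Set
Node n = Fin (ℕ.suc n)

record Instance (n : ℕ) : Set where
  field
    d        : Node n → Node n → ℕ
    isMetric : IsMetric _≡_ d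

-- An unordered pair of distinct nodes is represented by its larger element
-- together with a strictly smaller one.
Edge : ℕ → Set
Edge n = Σ (Node n) Fin′

hi lo : ∀ {n} → Edge n → Node n
hi = proj₁
lo (v , u) = inject u

∑Edge : ∀ {n} → (Edge n → ℚ) → ℚ
∑Edge f = ∑ℚ λ v → ∑ℚ λ u → f (v , u)

-- A path from r visiting all of 𝒟 is given by the order in which it visits
-- the nodes of 𝒟: P ⟨$⟩ʳ i is the one visited after i others.
Path : ℕ → Set
Path n = Permutation′ n

visit : ∀ {n} → Path n → Fin (ℕ.suc n) → Node n
visit P zero    = zero
visit P (suc i) = suc (P ⟨$⟩ʳ i)

module _ {n : ℕ} (I : Instance n) where
  open Instance I

  latency : Path n → Fin n → ℕ
  latency P j = ∑ℕ λ i →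
    if does (i Fin.≤? (P ⟨$⟩ˡ j))
    then d (visit P (inject₁ i)) (visit P (suc i))
    else 0

  totalLatency : Path n → ℕ
  totalLatency P = ∑ℕ (latency P)

  IsOptimalPath : Path n → Set
  IsOptimalPath P = ∀ Q → totalLatency P ℕ.≤ totalLatency Q

-- The times 1, …, T are indexed by Fin T.
time : ∀ {T} → Fin T → ℕ
time t = ℕ.suc (toℕ t)

-- The sum over δ(S); the root is never in S.
∑δ : ∀ {n} → Subset n → (Edge n → ℚ) → ℚ
∑δ S f = ∑Edge λ e →
  if lookup (outside ∷ S) (hi e) xor lookup (outside ∷ S) (lo e)
  then f e else 0ℚ

∑upTo : ∀ {T} → Fin T → (Fin T → ℚ) → ℚ
∑upTo t f = ∑ℚ λ t′ → if does (t′ Fin.≤? t) then f t′ else 0ℚ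

-- The data of the linear program are integers, so restricting it to rational
-- points does not change its optimal value.
record LP1Feasible {n} (I : Instance n) (T : ℕ)
                   (x : Fin n → Fin T → ℚ) (z : Edge n → Fin T → ℚ) : Set where
  open Instance I
  field
    x-nonneg : ∀ j t → 0ℚ ≤ x j t
    z-nonneg : ∀ e t → 0ℚ ≤ z e t
    x-zero   : ∀ j t → time t ℕ.< d (suc j) zero → x j t ≡ 0ℚ
    covered  : ∀ j → 1ℚ ≤ ∑ℚ (x j)
    length   : ∀ t → ∑Edge (λ e → ℕ→ℚ (d (hi e) (lo e)) * z e t) ≤ ℕ→ℚ (time t)
    cut      : ∀ t S j → j ∈ S → ∑upTo t (x j) ≤ ∑δ S (λ e → z e t)

LP1Objective : ∀ {n T} → (Fin n → Fin T → ℚ) → ℚ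
LP1Objective x = ∑ℚ λ j → ∑ℚ λ t → ℕ→ℚ (time t) * x j t

{-# OPTIONS --safe #-}

-- Let W(τ) = ∑_j ∑_{t > τ} x_{j,t}, the amount of demand that the linear program
-- leaves unserved at time τ; the objective is at least ∑_τ W(τ).
--
-- For every penalty rate, the Goemans–Williamson bound for prize-collecting
-- Steiner trees, applied to z_{·,τ} with penalty W(τ), yields a tree through the
-- root with cost(T) + 2 · penalty(missed) ≤ 2 (τ + penalty W(τ)). Doubling it
-- gives a tour of length L that misses m nodes, with (L , m) below a prescribed
-- line through (4τ , W(τ)). Concatenating tours for τ, 4τ, 16τ, …, each
-- traversed in its better direction, has total latency at most
-- ½ ∑ Lᵢ (uᵢ₋₁ + uᵢ), uᵢ being the number of nodes unvisited after the i-th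
-- tour (Goemans–Kleinberg). The penalty rates are chosen one after the other so
-- that this is at most what it would be for Lᵢ = 4τᵢ and uᵢ = W(τᵢ), which is
-- 2 τ n + 10 ∑ τᵢ W(τᵢ). Averaging over the starting times 1 and 2 bounds the
-- optimum by 10 ∑_τ W(τ).
module Submission where

open import Defs
import Algebra.Properties.CommutativeMonoid.Sum as Sum
open import Data.Bool.Base using (Bool; true; false; if_then_else_; _xor_; _∧_; not)
open import Data.Bool.Properties using (xor-same)
open import Data.Fin.Base
  using (Fin; zero; suc; toℕ; fromℕ; fromℕ<; cast; inject₁; punchOut; _↑ˡ_; _↑ʳ_; splitAt)
import Data.Fin.Permutation as Permutation
import Data.Fin.Properties as Fin
open import Data.Fin.Subset using (Subset; outside)
import Data.Integer.Base as ℤ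
import Data.Integer.Properties as ℤ
open import Data.List.Base using (List; []; _∷_; _++_; length; reverse; filterᵇ; lookup)
import Data.List.Properties as List
open import Data.Nat.Base as ℕ using (ℕ; zero; suc; z≤n; s≤s)
import Data.Nat.Properties as ℕ
import Data.Nat.Solver as ℕ
open import Data.Product.Base using (Σ; ∃-syntax; _×_; _,_; proj₁; proj₂; map₂)
open import Data.Rational.Base
open import Data.Rational.Properties as ℚ using ()
open import Data.Rational.Solver using (module +-*-Solver)
import Data.Rational.Unnormalised.Base as ℚᵘ
import Data.Rational.Unnormalised.Properties as ℚᵘ
open import Data.Sum.Base using (_⊎_; inj₁; inj₂; [_,_]′; swap; map₁)
open import Data.Unit.Base using (⊤; tt)
import Data.Vec.Base as Vec
import Data.Vec.Properties as Vec
open import Function.Base using (_∘_)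
open import Function.Metric.Nat.Structures using (module IsMetric)
open import Relation.Binary.PropositionalEquality
  using (_≡_; _≢_; refl; sym; trans; cong; cong₂; subst; subst₂; module ≡-Reasoning)
open import Relation.Nullary.Decidable using (Dec; does; yes; no; dec-true)
open import Relation.Nullary.Negation using (¬_; contradiction)

open +-*-Solver using (solve; _:=_; _:+_; _:*_; _:-_; con)
module ℕS = ℕ.+-*-Solver

-- No single tour need satisfy both L ≤ 4τ and m ≤ W(τ): a penalty rate controls only one weighted
-- sum of length and missed nodes. The cost of a tour is the product L (u + u′), so the useful rate
-- is the gradient of the bound at (4τ , W(τ)), and it depends on the number u of nodes actually
-- left by the earlier tours. This is why the rates cannot be fixed in advance. In the tree bound
-- the factor 2 stands on the missed penalty as well as on the right-hand side. It therefore
-- cancels: missed nodes are compared with W(τ) without loss, and only the length is inflated. The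
-- bound is proved by the local ratio method on multigraphs without any metric, so that free edges
-- can be contracted. The constant 10 is (4 + 16) / 2: a node missed by the tour for τ is charged
-- half of 4τ and half of the next length 16τ. The two sequences of times together use every power
-- of two once, and from τ = 2 on τ W(τ) is at most twice the sum of W over (τ/2, τ]. This doubles
-- the constant, and averaging the two sequences halves it again.

-- Rational arithmetic, finite sums and the largest feasible step.

2ℚ : ℚ
2ℚ = ℕ→ℚ 2

-- The form of most inequality proofs below: the slack `r` is assembled from the slacks of the
-- hypotheses by `0≤q-p`, `_0≤+_` and `_0≤*_`, and the identity is left to the ring solver.
≤-by : ∀ {p q} r → 0ℚ ≤ r → q ≡ p + r → p ≤ q
≤-by {p} r 0≤r refl = subst (_≤ p + r) (ℚ.+-identityʳ p) (ℚ.+-monoʳ-≤ p 0≤r)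

0≤q-p : ∀ {p q} → p ≤ q → 0ℚ ≤ q - p
0≤q-p {p} {q} p≤q = subst (_≤ q - p) (ℚ.+-inverseʳ p) (ℚ.+-monoˡ-≤ (- p) p≤q)

infixl 6 _0≤+_
infixl 7 _0≤*_

_0≤+_ : ∀ {p q} → 0ℚ ≤ p → 0ℚ ≤ q → 0ℚ ≤ p + q
_0≤+_ = ℚ.+-mono-≤

_0≤*_ : ∀ {p q} → 0ℚ ≤ p → 0ℚ ≤ q → 0ℚ ≤ p * q
_0≤*_ {p} {q} 0≤p 0≤q =
  subst (_≤ p * q) (ℚ.*-zeroʳ p) (ℚ.*-monoˡ-≤-nonNeg p {{nonNegative 0≤p}} 0≤q)

0≤1 : 0ℚ ≤ 1ℚ
0≤1 = *≤* (ℤ.+≤+ z≤n)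

0≤2 : 0ℚ ≤ 2ℚ
0≤2 = *≤* (ℤ.+≤+ z≤n)

toℚᵘ-ℕ→ℚ : ∀ k → toℚᵘ (ℕ→ℚ k) ℚᵘ.≃ ℚᵘ.mkℚᵘ (ℤ.+ k) 0
toℚᵘ-ℕ→ℚ k = ℚ.toℚᵘ-fromℚᵘ (ℚᵘ.mkℚᵘ (ℤ.+ k) 0)

ℕ→ℚ-mono-≤ : ∀ {a b} → a ℕ.≤ b → ℕ→ℚ a ≤ ℕ→ℚ b
ℕ→ℚ-mono-≤ {a} {b} a≤b = ℚ.toℚᵘ-cancel-≤ (ℚᵘ.≤-trans
  (ℚᵘ.≤-reflexive (toℚᵘ-ℕ→ℚ a))
  (ℚᵘ.≤-trans
    (ℚᵘ.*≤* (ℤ.*-monoʳ-≤-nonNeg (ℤ.+ 1) (ℤ.+≤+ a≤b)))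
    (ℚᵘ.≤-reflexive (ℚᵘ.≃-sym (toℚᵘ-ℕ→ℚ b)))))

ℕ→ℚ-nonNeg : ∀ k → 0ℚ ≤ ℕ→ℚ k
ℕ→ℚ-nonNeg k = ℕ→ℚ-mono-≤ {0} {k} z≤n

ℕ→ℚ-+ : ∀ a b → ℕ→ℚ (a ℕ.+ b) ≡ ℕ→ℚ a + ℕ→ℚ b
ℕ→ℚ-+ a b = ℚ.toℚᵘ-injective (begin
  toℚᵘ (ℕ→ℚ (a ℕ.+ b))                            ≈⟨ toℚᵘ-ℕ→ℚ (a ℕ.+ b) ⟩
  ℚᵘ.mkℚᵘ (ℤ.+ (a ℕ.+ b)) 0                       ≈⟨ ℚᵘ.*≡*
      (cong (ℤ._* ℤ.+ 1) (cong₂ ℤ._+_ (sym (ℤ.*-identityʳ (ℤ.+ a))) (sym (ℤ.*-identityʳ (ℤ.+ b))))) ⟩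
  ℚᵘ.mkℚᵘ (ℤ.+ a) 0 ℚᵘ.+ ℚᵘ.mkℚᵘ (ℤ.+ b) 0        ≈⟨ ℚᵘ.+-cong (toℚᵘ-ℕ→ℚ a) (toℚᵘ-ℕ→ℚ b) ⟨
  toℚᵘ (ℕ→ℚ a) ℚᵘ.+ toℚᵘ (ℕ→ℚ b)                  ≈⟨ ℚ.toℚᵘ-homo-+ (ℕ→ℚ a) (ℕ→ℚ b) ⟨
  toℚᵘ (ℕ→ℚ a + ℕ→ℚ b)                            ∎)
  where open ℚᵘ.≃-Reasoning

ℕ→ℚ-suc : ∀ k → ℕ→ℚ (suc k) ≡ 1ℚ + ℕ→ℚ k
ℕ→ℚ-suc = ℕ→ℚ-+ 1

ℕ→ℚ-* : ∀ a b → ℕ→ℚ (a ℕ.* b) ≡ ℕ→ℚ a * ℕ→ℚ b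
ℕ→ℚ-* zero b = sym (ℚ.*-zeroˡ (ℕ→ℚ b))
ℕ→ℚ-* (suc a) b = begin
  ℕ→ℚ (b ℕ.+ a ℕ.* b)           ≡⟨ ℕ→ℚ-+ b (a ℕ.* b) ⟩
  ℕ→ℚ b + ℕ→ℚ (a ℕ.* b)         ≡⟨ cong (ℕ→ℚ b +_) (ℕ→ℚ-* a b) ⟩
  ℕ→ℚ b + ℕ→ℚ a * ℕ→ℚ b         ≡⟨ solve 2 (λ x y → y :+ x :* y := (con 1ℚ :+ x) :* y) refl
      (ℕ→ℚ a) (ℕ→ℚ b) ⟩
  (1ℚ + ℕ→ℚ a) * ℕ→ℚ b          ≡⟨ cong (_* ℕ→ℚ b) (ℕ→ℚ-suc a) ⟨
  ℕ→ℚ (suc a) * ℕ→ℚ b           ∎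
  where open ≡-Reasoning

𝟙 : Bool → ℚ
𝟙 b = if b then 1ℚ else 0ℚ

infix 4 _≡ᵇ_

_≡ᵇ_ : ∀ {n} → Fin n → Fin n → Bool
x ≡ᵇ y = does (x Fin.≟ y)

≡ᵇ-refl : ∀ {n} (x : Fin n) → (x ≡ᵇ x) ≡ true
≡ᵇ-refl x with x Fin.≟ x
... | yes _  = refl
... | no x≢x = contradiction refl x≢x

≢⇒≡ᵇ-false : ∀ {n} {x y : Fin n} → x ≢ y → (x ≡ᵇ y) ≡ false
≢⇒≡ᵇ-false {x = x} {y} x≢y with x Fin.≟ y
... | yes x≡y = contradiction x≡y x≢y
... | no _    = refl

if-nonNeg : ∀ b {p} → 0ℚ ≤ p → 0ℚ ≤ (if b then p else 0ℚ)
if-nonNeg true  0≤p = 0≤p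
if-nonNeg false _   = ℚ.≤-refl

∑-cong : ∀ {n} {f g : Fin n → ℚ} → (∀ i → f i ≡ g i) → ∑ℚ f ≡ ∑ℚ g
∑-cong {zero}  f≡g = refl
∑-cong {suc n} f≡g = cong₂ _+_ (f≡g zero) (∑-cong (f≡g ∘ suc))

∑-mono : ∀ {n} {f g : Fin n → ℚ} → (∀ i → f i ≤ g i) → ∑ℚ f ≤ ∑ℚ g
∑-mono {zero}  f≤g = ℚ.≤-refl
∑-mono {suc n} f≤g = ℚ.+-mono-≤ (f≤g zero) (∑-mono (f≤g ∘ suc))

∑-nonNeg : ∀ {n} {f : Fin n → ℚ} → (∀ i → 0ℚ ≤ f i) → 0ℚ ≤ ∑ℚ f
∑-nonNeg {zero}  0≤f = ℚ.≤-refl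
∑-nonNeg {suc n} 0≤f = 0≤f zero 0≤+ ∑-nonNeg (0≤f ∘ suc)

∑-+ : ∀ {n} (f g : Fin n → ℚ) → ∑ℚ (λ i → f i + g i) ≡ ∑ℚ f + ∑ℚ g
∑-+ = Sum.∑-distrib-+ ℚ.+-0-commutativeMonoid

∑-*ˡ : ∀ {n} p (f : Fin n → ℚ) → ∑ℚ (λ i → p * f i) ≡ p * ∑ℚ f
∑-*ˡ {zero}  p f = sym (ℚ.*-zeroʳ p)
∑-*ˡ {suc n} p f = trans (cong (p * f zero +_) (∑-*ˡ p (f ∘ suc)))
                         (sym (ℚ.*-distribˡ-+ p (f zero) (∑ℚ (f ∘ suc))))

∑-comm : ∀ {m n} (f : Fin m → Fin n → ℚ) →
         ∑ℚ (λ i → ∑ℚ (λ j → f i j)) ≡ ∑ℚ (λ j → ∑ℚ (λ i → f i j))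
∑-comm = Sum.∑-comm ℚ.+-0-commutativeMonoid

∑-zero : ∀ n → ∑ℚ {n} (λ _ → 0ℚ) ≡ 0ℚ
∑-zero zero    = refl
∑-zero (suc n) = trans (ℚ.+-identityˡ _) (∑-zero n)

∑-indicator : ∀ {n} x (f : Fin n → ℚ) → ∑ℚ (λ v → if x ≡ᵇ v then f v else 0ℚ) ≡ f x
∑-indicator {suc n} zero    f = trans (cong (f zero +_) (∑-zero n)) (ℚ.+-identityʳ (f zero))
∑-indicator {suc n} (suc x) f = trans (ℚ.+-identityˡ (∑ℚ (λ v → if x ≡ᵇ v then f (suc v) else 0ℚ)))
                                      (∑-indicator x (f ∘ suc))

∑ℕ-mono : ∀ {n} {f g : Fin n → ℕ} → (∀ i → f i ℕ.≤ g i) → ∑ℕ f ℕ.≤ ∑ℕ g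
∑ℕ-mono {zero}  f≤g = z≤n
∑ℕ-mono {suc n} f≤g = ℕ.+-mono-≤ (f≤g zero) (∑ℕ-mono (f≤g ∘ suc))

∑ℕ-mono-< : ∀ {n} {f g : Fin n → ℕ} → (∀ i → f i ℕ.≤ g i) → ∀ i → f i ℕ.< g i →
            ∑ℕ f ℕ.< ∑ℕ g
∑ℕ-mono-< f≤g zero    f<g = ℕ.+-mono-<-≤ f<g (∑ℕ-mono (f≤g ∘ suc))
∑ℕ-mono-< f≤g (suc i) f<g = ℕ.+-mono-≤-< (f≤g zero) (∑ℕ-mono-< (f≤g ∘ suc) i f<g)

-- The largest step ε along a direction k ≥ 0 that stays within the bounds b ≥ 0.
max-step : ∀ {m} (k b : Fin m → ℚ) → (∀ i → 0ℚ ≤ k i) → (∀ i → 0ℚ ≤ b i) →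
           (∀ i → k i ≡ 0ℚ) ⊎
           (∃[ ε ] 0ℚ ≤ ε × (∀ i → ε * k i ≤ b i) × ∃[ i ] 0ℚ < k i × ε * k i ≡ b i)
max-step {zero}  k b 0≤k 0≤b = inj₁ λ ()
max-step {suc m} k b 0≤k 0≤b
  with max-step (k ∘ suc) (b ∘ suc) (0≤k ∘ suc) (0≤b ∘ suc) | 0ℚ ℚ.<? k zero
... | inj₁ k≡0 | no k₀≯0 = inj₁ λ where
  zero    → ℚ.≤-antisym (ℚ.≮⇒≥ k₀≯0) (0≤k zero)
  (suc i) → k≡0 i
... | inj₂ (ε , 0≤ε , εk≤b , i , 0<kᵢ , εkᵢ≡bᵢ) | no k₀≯0 =
  inj₂ (ε , 0≤ε , bound , suc i , 0<kᵢ , εkᵢ≡bᵢ)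
  where
  bound : ∀ i → ε * k i ≤ b i
  bound zero    = subst (_≤ b zero)
    (sym (trans (cong (ε *_) (ℚ.≤-antisym (ℚ.≮⇒≥ k₀≯0) (0≤k zero))) (ℚ.*-zeroʳ ε))) (0≤b zero)
  bound (suc i) = εk≤b i
... | rest | yes 0<k₀ = choose rest
  where
  instance
    k₀-pos : Positive (k zero)
    k₀-pos = positive 0<k₀
    k₀-nz : NonZero (k zero)
    k₀-nz = ℚ.pos⇒nonZero (k zero)
  ε₀ : ℚ
  ε₀ = b zero * 1/ (k zero)
  ε₀k₀≡b₀ : ε₀ * k zero ≡ b zero
  ε₀k₀≡b₀ = trans (ℚ.*-assoc (b zero) (1/ k zero) (k zero))
    (trans (cong (b zero *_) (ℚ.*-inverseˡ (k zero))) (ℚ.*-identityʳ (b zero)))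
  0≤ε₀ : 0ℚ ≤ ε₀
  0≤ε₀ = 0≤b zero 0≤* ℚ.<⇒≤ (ℚ.positive⁻¹ (1/ k zero) {{ℚ.1/pos⇒pos (k zero)}})
  choose : (∀ i → k (suc i) ≡ 0ℚ) ⊎
           (∃[ ε ] 0ℚ ≤ ε × (∀ i → ε * k (suc i) ≤ b (suc i)) ×
             ∃[ i ] 0ℚ < k (suc i) × ε * k (suc i) ≡ b (suc i)) →
           (∀ i → k i ≡ 0ℚ) ⊎
           (∃[ ε ] 0ℚ ≤ ε × (∀ i → ε * k i ≤ b i) × ∃[ i ] 0ℚ < k i × ε * k i ≡ b i)
  choose (inj₁ k≡0) = inj₂ (ε₀ , 0≤ε₀ , bound , zero , 0<k₀ , ε₀k₀≡b₀)
    where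
    bound : ∀ i → ε₀ * k i ≤ b i
    bound zero    = ℚ.≤-reflexive ε₀k₀≡b₀
    bound (suc i) = subst (_≤ b (suc i))
      (sym (trans (cong (ε₀ *_) (k≡0 i)) (ℚ.*-zeroʳ ε₀))) (0≤b (suc i))
  choose (inj₂ (ε , 0≤ε , εk≤b , i , 0<kᵢ , εkᵢ≡bᵢ)) with ε * k zero ℚ.≤? b zero
  ... | yes εk₀≤b₀ = inj₂ (ε , 0≤ε , bound , suc i , 0<kᵢ , εkᵢ≡bᵢ)
    where
    bound : ∀ i → ε * k i ≤ b i
    bound zero    = εk₀≤b₀
    bound (suc i) = εk≤b i
  ... | no εk₀≰b₀ = inj₂ (ε₀ , 0≤ε₀ , bound , zero , 0<k₀ , ε₀k₀≡b₀)
    where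
    ε₀≤ε : ε₀ ≤ ε
    ε₀≤ε = ℚ.*-cancelʳ-≤-pos (k zero)
      (subst (_≤ ε * k zero) (sym ε₀k₀≡b₀) (ℚ.<⇒≤ (ℚ.≰⇒> εk₀≰b₀)))
    bound : ∀ i → ε₀ * k i ≤ b i
    bound zero    = ℚ.≤-reflexive ε₀k₀≡b₀
    bound (suc i) = ℚ.≤-trans
      (ℚ.*-monoʳ-≤-nonNeg (k (suc i)) {{nonNegative (0≤k (suc i))}} ε₀≤ε) (εk≤b i)

-- Rooted forests and the degree count.

does-true⁻ : ∀ {A : Set} (a? : Dec A) → does a? ≡ true → A
does-true⁻ (yes a) _ = a

-- node v e ks ss is a tree whose top v hangs by the edge e on a parent not
-- recorded here, with the forest ks below v, followed by the siblings ss.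
data Forest (V E : Set) : Set where
  []   : Forest V E
  node : V → E → Forest V E → Forest V E → Forest V E

∑F : ∀ {V E} → (V → E → ℚ) → Forest V E → ℚ
∑F g []             = 0ℚ
∑F g (node v e ks ss) = g v e + (∑F g ks + ∑F g ss)

module _ {V E : Set} where

  cost : (E → ℚ) → Forest V E → ℚ
  cost c = ∑F λ _ e → c e

  weight : (V → ℚ) → Forest V E → ℚ
  weight π = ∑F λ v _ → π v

  ∑F-sub : ∀ (f g : V → E → ℚ) ε (t : Forest V E) →
           ∑F (λ v e → f v e - ε * g v e) t ≡ ∑F f t - ε * ∑F g t
  ∑F-sub f g ε [] = solve 1 (λ ε → con 0ℚ := con 0ℚ :- ε :* con 0ℚ) refl ε
  ∑F-sub f g ε (node v e ks ss) rewrite ∑F-sub f g ε ks | ∑F-sub f g ε ss =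
    solve 7 (λ a b c d x y ε → (a :- ε :* b) :+ ((c :- ε :* d) :+ (x :- ε :* y)) :=
                               (a :+ (c :+ x)) :- ε :* (b :+ (d :+ y)))
      refl (f v e) (g v e) (∑F f ks) (∑F g ks) (∑F f ss) (∑F g ss) ε

  Joins : (E → V) → (E → V) → E → V → V → Set
  Joins h l e x y = (h e ≡ x × l e ≡ y) ⊎ (h e ≡ y × l e ≡ x)

  -- The pruning condition. It survives raising the penalties, and it is what makes the degree count
  -- work: an inactive vertex of the forest has a child.
  PositiveLeaves : (V → ℚ) → Forest V E → Set
  PositiveLeaves π []               = ⊤
  PositiveLeaves π (node v e ks ss) =
    (ks ≡ [] → 0ℚ < π v) × PositiveLeaves π ks × PositiveLeaves π ss

  -- The number of trees, that is, of children of the vertex on which the forest hangs.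
  width : Forest V E → ℚ
  width []               = 0ℚ
  width (node v e ks ss) = 1ℚ + width ss

  0≤width : ∀ t → 0ℚ ≤ width t
  0≤width []               = ℚ.≤-refl
  0≤width (node v e ks ss) = 0≤1 0≤+ 0≤width ss

module _ {n : ℕ} {E : Set} where

  occurs : Node n → Forest (Node n) E → ℕ
  occurs x []               = 0
  occurs x (node v e ks ss) = (if x ≡ᵇ v then 1 else 0) ℕ.+ (occurs x ks ℕ.+ occurs x ss)

  HangsOn : (h l : E → Node n) → Node n → Forest (Node n) E → Set
  HangsOn h l p []               = ⊤
  HangsOn h l p (node v e ks ss) =
    v ≢ zero × Joins h l e p v × HangsOn h l v ks × HangsOn h l p ss

  -- Vertices with α v = 0 are not leaves, so they have degree at least 2, and the
  -- average degree of the others is below 2.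
  degree-sum : ∀ (h l : E → Node n) (π α : Node n → ℚ) (κ : E → ℚ) →
    (∀ v → α v ≤ 1ℚ) → (∀ v → v ≢ zero → 0ℚ < π v → α v ≡ 1ℚ) →
    (∀ {e x y} → Joins h l e x y → κ e ≤ α x + α y) →
    ∀ p t → HangsOn h l p t → PositiveLeaves π t →
    cost κ t ≤ 2ℚ * weight α t + (α p - 1ℚ) * width t
  degree-sum h l π α κ α≤1 α≡1 κ≤ p [] _ _ =
    ℚ.≤-reflexive (solve 1 (λ a → con 0ℚ := con 2ℚ :* con 0ℚ :+ (a :- con 1ℚ) :* con 0ℚ) refl (α p))
  degree-sum h l π α κ α≤1 α≡1 κ≤ p (node v e ks ss) (v≢0 , j , hk , hs) (lf , pk , ps) =
    ≤-by _ ((((0≤q-p (κ≤ j)) 0≤+ 0≤q-p (degree-sum h l π α κ α≤1 α≡1 κ≤ v ks hk pk))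
             0≤+ 0≤q-p (degree-sum h l π α κ α≤1 α≡1 κ≤ p ss hs ps)) 0≤+ spare ks lf)
      (solve 9 (λ κe ap av ck wk dk cs ws ds →
         con 2ℚ :* (av :+ (wk :+ ws)) :+ (ap :- con 1ℚ) :* (con 1ℚ :+ ds) :=
         (κe :+ (ck :+ cs)) :+
         ((((ap :+ av :- κe) :+ (con 2ℚ :* wk :+ (av :- con 1ℚ) :* dk :- ck)) :+
           (con 2ℚ :* ws :+ (ap :- con 1ℚ) :* ds :- cs)) :+ (con 1ℚ :- av) :* (dk :- con 1ℚ)))
        refl (κ e) (α p) (α v) (cost κ ks) (weight α ks) (width ks) (cost κ ss) (weight α ss) (width ss))
    where
    -- This is what remains of the degree of `v`: for a leaf the first factor is 0, and otherwise
    -- there is a child and the second factor is nonnegative.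
    spare : ∀ ks → (ks ≡ [] → 0ℚ < π v) → 0ℚ ≤ (1ℚ - α v) * (width ks - 1ℚ)
    spare [] lf rewrite α≡1 v v≢0 (lf refl) = ℚ.≤-refl
    spare (node _ _ _ ss) _ = 0≤q-p (α≤1 v) 0≤*
      subst (0ℚ ≤_) (solve 1 (λ w → w := con 1ℚ :+ w :- con 1ℚ) refl (width ss)) (0≤width ss)

∑-sub : ∀ {m} (f g : Fin m → ℚ) ε → ∑ℚ (λ i → f i - ε * g i) ≡ ∑ℚ f - ε * ∑ℚ g
∑-sub {zero}  f g ε = solve 1 (λ ε → con 0ℚ := con 0ℚ :- ε :* con 0ℚ) refl ε
∑-sub {suc m} f g ε = trans (cong (f zero - ε * g zero +_) (∑-sub (f ∘ suc) (g ∘ suc) ε))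
  (solve 5 (λ a b c d ε → (a :- ε :* b) :+ (c :- ε :* d) := (a :+ c) :- ε :* (b :+ d))
    refl (f zero) (g zero) (∑ℚ (f ∘ suc)) (∑ℚ (g ∘ suc)) ε)

-- The two spikes add the same `p` to both totals. Needed for contraction, which moves weight
-- between two vertices, so that the sums cannot be compared term by term.
∑-transfer : ∀ {m} (a b : Fin m) p (f g : Fin m → ℚ) →
  (∀ x → g x + (if a ≡ᵇ x then p else 0ℚ) ≤ f x + (if b ≡ᵇ x then p else 0ℚ)) → ∑ℚ g ≤ ∑ℚ f
∑-transfer a b p f g g≤f = ≤-by _ (0≤q-p (∑-mono g≤f))
  (trans (solve 3 (λ f g p → f := g :+ (f :+ p :- (g :+ p))) refl (∑ℚ f) (∑ℚ g) p)
    (cong₂ (λ x y → ∑ℚ g + (x - y)) (∑-spike f b) (∑-spike g a)))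
  where
  ∑-spike : ∀ f a → ∑ℚ f + p ≡ ∑ℚ (λ x → f x + (if a ≡ᵇ x then p else 0ℚ))
  ∑-spike f a = trans (cong (∑ℚ f +_) (sym (∑-indicator a (λ _ → p))))
                      (sym (∑-+ f (λ x → if a ≡ᵇ x then p else 0ℚ)))

occurs-root : ∀ {n E} {h l : E → Node n} {p} (t : Forest (Node n) E) → HangsOn h l p t →
    occurs zero t ≡ 0
occurs-root [] _ = refl
occurs-root (node zero    e ks ss) (v≢0 , _) = contradiction refl v≢0
occurs-root (node (suc v) e ks ss) (_ , _ , hk , hs) = cong₂ ℕ._+_ (occurs-root ks hk)
    (occurs-root ss hs)

count-mono : ∀ b b′ → (b ≡ true → b′ ≡ true) → (if b then 1 else 0) ℕ.≤ (if b′ then 1 else 0)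
count-mono false b′ _ = z≤n
count-mono true b′ b⇒b′ rewrite b⇒b′ refl = ℕ.≤-refl

count-mono-< : ∀ b b′ → b ≢ true → b′ ≡ true → (if b then 1 else 0) ℕ.< (if b′ then 1 else 0)
count-mono-< true  b′ b≢true _ = contradiction refl b≢true
count-mono-< false b′ _ refl   = ℕ.≤-refl

positive-𝟙 : ∀ b → 0ℚ < 𝟙 b → b ≡ true
positive-𝟙 true  _   = refl
positive-𝟙 false 0<0 = contradiction 0<0 (ℚ.<-irrefl refl)

-- The prize-collecting tree bound: unit costs and unit penalties.

module PrizeCollecting {n M : ℕ} (z : Fin M → ℚ) (0≤z : ∀ e → 0ℚ ≤ z e) where

  cutWeight : (h l : Fin M → Node n) → (Node n → Bool) → ℚ
  cutWeight h l S = ∑ℚ λ e → if S (h e) xor S (l e) then z e else 0ℚ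

  -- Vertices and edge indices stay fixed and only `h` and `l` vary, so contraction merely redirects
  -- ends and may create loops. `s v` is the fraction of `v` that `z` leaves unserved.
  record Problem : Set where
    field
      h l : Fin M → Node n
      c   : Fin M → ℚ
      π s : Node n → ℚ
      0≤c : ∀ e → 0ℚ ≤ c e
      0≤π : ∀ v → 0ℚ ≤ π v
      0≤s : ∀ v → 0ℚ ≤ s v
      cut : ∀ S v → S zero ≡ false → S v ≡ true → 1ℚ ≤ cutWeight h l S + s v

  -- Twice the collected penalty is added on both sides, which avoids speaking of missed vertices.
  -- The root counts as collected, since contraction can move penalty into it.
  Solution : Problem → Set
  Solution I = ∃[ t ] HangsOn h l zero t × PositiveLeaves π t × (∀ v → occurs v t ℕ.≤ 1) ×
      cost c t + 2ℚ * ∑ℚ π ≤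
      2ℚ * (∑ℚ (λ e → z e * c e) + ∑ℚ (λ v → π v * s v)) + 2ℚ * (π zero + weight π t)
    where open Problem I

  module Active (I : Problem) where
    open Problem I

    active : Node n → Bool
    active v = not (v ≡ᵇ zero) ∧ does (0ℚ ℚ.<? π v)

    α : Node n → ℚ
    α v = 𝟙 (active v)

    -- The number of active ends of an edge, and 0 for a loop: the rate at which the edge is used up
    -- when every active vertex grows a moat at unit speed.
    κ : Fin M → ℚ
    κ e = ∑ℚ λ v → if (h e ≡ᵇ v) xor (l e ≡ᵇ v) then α v else 0ℚ

    active⁺ : ∀ v → v ≢ zero → 0ℚ < π v → active v ≡ true
    active⁺ v v≢0 0<π rewrite ≢⇒≡ᵇ-false v≢0 = dec-true (0ℚ ℚ.<? π v) 0<π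

    active⁻ : ∀ v → active v ≡ true → v ≢ zero × 0ℚ < π v
    active⁻ v eq with v Fin.≟ zero
    ... | no v≢0 = v≢0 , does-true⁻ (0ℚ ℚ.<? π v) eq

    0≤α : ∀ v → 0ℚ ≤ α v
    0≤α v = if-nonNeg (active v) 0≤1

    α≤1 : ∀ v → α v ≤ 1ℚ
    α≤1 v with active v
    ... | true  = ℚ.≤-refl
    ... | false = 0≤1

    α-active : ∀ v → v ≢ zero → 0ℚ < π v → α v ≡ 1ℚ
    α-active v v≢0 0<π = cong 𝟙 (active⁺ v v≢0 0<π)

    0≤κ : ∀ e → 0ℚ ≤ κ e
    0≤κ e = ∑-nonNeg λ v → if-nonNeg ((h e ≡ᵇ v) xor (l e ≡ᵇ v)) (0≤α v)

    κ-ends : ∀ e → κ e ≤ α (h e) + α (l e)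
    κ-ends e = begin
      κ e ≤⟨ ∑-mono (λ v → split (h e ≡ᵇ v) (l e ≡ᵇ v) (0≤α v)) ⟩
      ∑ℚ (λ v → (if h e ≡ᵇ v then α v else 0ℚ) + (if l e ≡ᵇ v then α v else 0ℚ))
        ≡⟨ ∑-+ (λ v → if h e ≡ᵇ v then α v else 0ℚ) (λ v → if l e ≡ᵇ v then α v else 0ℚ) ⟩
      ∑ℚ (λ v → if h e ≡ᵇ v then α v else 0ℚ) + ∑ℚ (λ v → if l e ≡ᵇ v then α v else 0ℚ)
        ≡⟨ cong₂ _+_ (∑-indicator (h e) α) (∑-indicator (l e) α) ⟩
      α (h e) + α (l e) ∎
      where
      open ℚ.≤-Reasoning
      split : ∀ b b′ {p} → 0ℚ ≤ p →
              (if b xor b′ then p else 0ℚ) ≤ (if b then p else 0ℚ) + (if b′ then p else 0ℚ)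
      split true  true  0≤p = 0≤p 0≤+ 0≤p
      split true  false {p} 0≤p = ℚ.≤-reflexive (sym (ℚ.+-identityʳ p))
      split false true  {p} 0≤p = ℚ.≤-reflexive (sym (ℚ.+-identityˡ p))
      split false false 0≤p = ℚ.≤-refl

    κ-joins : ∀ {e x y} → Joins h l e x y → κ e ≤ α x + α y
    κ-joins {e} (inj₁ (refl , refl)) = κ-ends e
    κ-joins {e} (inj₂ (refl , refl)) = ℚ.≤-trans (κ-ends e)
        (ℚ.≤-reflexive (ℚ.+-comm (α (h e)) (α (l e))))

    κ-loop : ∀ e → h e ≡ l e → κ e ≡ 0ℚ
    κ-loop e he≡le = trans
      (∑-cong λ v → cong (λ b → if b then α v else 0ℚ)
        (trans (cong (λ x → (x ≡ᵇ v) xor (l e ≡ᵇ v)) he≡le) (xor-same (l e ≡ᵇ v))))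
      (∑-zero (suc n))

    star : Node n → ℚ
    star v = cutWeight h l (_≡ᵇ v)

    ∑zκ : ∑ℚ (λ e → z e * κ e) ≡ ∑ℚ (λ v → α v * star v)
    ∑zκ = begin
      ∑ℚ (λ e → z e * κ e)
        ≡⟨ ∑-cong (λ e → sym (∑-*ˡ (z e) (λ v → if end e v then α v else 0ℚ))) ⟩
      ∑ℚ (λ e → ∑ℚ (λ v → z e * (if end e v then α v else 0ℚ)))
        ≡⟨ ∑-comm (λ e v → z e * (if end e v then α v else 0ℚ)) ⟩
      ∑ℚ (λ v → ∑ℚ (λ e → z e * (if end e v then α v else 0ℚ)))
        ≡⟨ ∑-cong (λ v → ∑-cong (λ e → move (end e v) (z e) (α v))) ⟩
      ∑ℚ (λ v → ∑ℚ (λ e → α v * (if end e v then z e else 0ℚ)))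
        ≡⟨ ∑-cong (λ v → ∑-*ˡ (α v) (λ e → if end e v then z e else 0ℚ)) ⟩
      ∑ℚ (λ v → α v * star v) ∎
      where
      open ≡-Reasoning
      end : Fin M → Node n → Bool
      end e v = (h e ≡ᵇ v) xor (l e ≡ᵇ v)
      move : ∀ b p q → p * (if b then q else 0ℚ) ≡ q * (if b then p else 0ℚ)
      move true  p q = ℚ.*-comm p q
      move false p q = trans (ℚ.*-zeroʳ p) (sym (ℚ.*-zeroʳ q))

    -- The cut constraints of the active singletons, added up: the fractional value of the problem
    -- with costs `κ` and penalties `α` is at least the number of active vertices.
    ∑α≤ : ∑ℚ α ≤ ∑ℚ (λ e → z e * κ e) + ∑ℚ (λ v → α v * s v)
    ∑α≤ = begin
      ∑ℚ α ≤⟨ ∑-mono pointwise ⟩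
      ∑ℚ (λ v → α v * star v + α v * s v) ≡⟨ ∑-+ (λ v → α v * star v) (λ v → α v * s v) ⟩
      ∑ℚ (λ v → α v * star v) + ∑ℚ (λ v → α v * s v) ≡⟨ cong (_+ ∑ℚ (λ v → α v * s v)) ∑zκ ⟨
      ∑ℚ (λ e → z e * κ e) + ∑ℚ (λ v → α v * s v) ∎
      where
      open ℚ.≤-Reasoning
      pointwise : ∀ v → α v ≤ α v * star v + α v * s v
      pointwise v with active v in eq
      ... | false = ℚ.≤-reflexive (solve 2 (λ a b → con 0ℚ := con 0ℚ :* a :+ con 0ℚ :* b) refl
          (star v) (s v))
      ... | true  = subst (1ℚ ≤_)
        (solve 2 (λ a b → a :+ b := con 1ℚ :* a :+ con 1ℚ :* b) refl (star v) (s v))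
        (cut (_≡ᵇ v) v (≢⇒≡ᵇ-false (λ 0≡v → proj₁ (active⁻ v eq) (sym 0≡v))) (≡ᵇ-refl v))

    module _ (ε : ℚ) (0≤ε : 0ℚ ≤ ε) (εκ≤c : ∀ e → ε * κ e ≤ c e) (εα≤π : ∀ v → ε * α v ≤ π v) where

      lowered : Problem
      lowered = record
        { h = h ; l = l ; c = λ e → c e - ε * κ e ; π = λ v → π v - ε * α v ; s = s
        ; 0≤c = λ e → 0≤q-p (εκ≤c e) ; 0≤π = λ v → 0≤q-p (εα≤π v) ; 0≤s = 0≤s ; cut = cut }

      lowered-π≤ : ∀ v → π v - ε * α v ≤ π v
      lowered-π≤ v = ≤-by (ε * α v) (0≤ε 0≤* 0≤α v)
        (solve 2 (λ p q → p := p :- q :+ q) refl (π v) (ε * α v))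

      raise-leaves : ∀ {E} (t : Forest (Node n) E) → PositiveLeaves (Problem.π lowered) t →
          PositiveLeaves π t
      raise-leaves []               _              = tt
      raise-leaves (node v e ks ss) (lf , pk , ps) =
        (λ eq → ℚ.<-≤-trans (lf eq) (lowered-π≤ v)) , raise-leaves ks pk , raise-leaves ss ps

      -- The bound is linear in costs and penalties. For `I` it is the bound for the lowered problem
      -- plus ε times the bound for (`κ`, `α`), which follows from `∑α≤` and `degree`.
      raise : Solution lowered → Solution I
      raise (t , hangs , leaves , occ , bound) = t , hangs , raise-leaves t leaves , occ ,
        ≤-by _ (0≤q-p bound′ 0≤+ 0≤ε 0≤* (0≤2 0≤* 0≤q-p ∑α≤ 0≤+ 0≤q-p degree))
          (solve 12 (λ C P Z Q p w K A Zk Qa a ε →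
              con 2ℚ :* (Z :+ Q) :+ con 2ℚ :* (p :+ w) :=
              C :+ con 2ℚ :* P :+
              ((con 2ℚ :* ((Z :- ε :* Zk) :+ (Q :- ε :* Qa)) :+ con 2ℚ
                  :* ((p :- ε :* con 0ℚ) :+ (w :- ε :* a))
                :- (C :- ε :* K :+ con 2ℚ :* (P :- ε :* A)))
               :+ ε :* (con 2ℚ :* (Zk :+ Qa :- A) :+ (con 2ℚ :* a :- K))))
            refl (cost c t) (∑ℚ π) (∑ℚ (λ e → z e * c e)) (∑ℚ (λ v → π v * s v)) (π zero) (weight π t)
              (cost κ t) (∑ℚ α) (∑ℚ (λ e → z e * κ e)) (∑ℚ (λ v → α v * s v)) (weight α t) ε)
        where
        bound′ : cost c t - ε * cost κ t + 2ℚ * (∑ℚ π - ε * ∑ℚ α) ≤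
                 2ℚ * ((∑ℚ (λ e → z e * c e) - ε * ∑ℚ (λ e → z e * κ e)) +
                       (∑ℚ (λ v → π v * s v) - ε * ∑ℚ (λ v → α v * s v))) +
                 2ℚ * ((π zero - ε * 0ℚ) + (weight π t - ε * weight α t))
        bound′ = subst₂ _≤_
          (cong₂ (λ a b → a + 2ℚ * b) (∑F-sub (λ _ e → c e) (λ _ e → κ e) ε t) (∑-sub π α ε))
          (cong₂ (λ a b → 2ℚ * a + 2ℚ * ((π zero - ε * 0ℚ) + b))
            (cong₂ _+_
              (trans (∑-cong λ e → solve 4 (λ z c ε k → z :* (c :- ε :* k) := z :* c :- ε
                  :* (z :* k)) refl (z e) (c e) ε (κ e))
                     (∑-sub (λ e → z e * c e) (λ e → z e * κ e) ε))
              (trans (∑-cong λ v → solve 4 (λ p s ε a → (p :- ε :* a) :* s := p :* s :- ε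
                  :* (a :* s)) refl (π v) (s v) ε (α v))
                     (∑-sub (λ v → π v * s v) (λ v → α v * s v) ε)))
            (∑F-sub (λ v _ → π v) (λ v _ → α v) ε t))
          bound
        degree : cost κ t ≤ 2ℚ * weight α t
        degree = ℚ.≤-trans (degree-sum h l π α κ α≤1 α-active κ-joins zero t hangs
            (raise-leaves t leaves))
          (≤-by (width t) (0≤width t)
            (solve 2 (λ a w → con 2ℚ :* a := con 2ℚ :* a :+ (con 0ℚ :- con 1ℚ) :* w :+ w) refl
                (weight α t) (width t)))

  -- Contracting a free edge and lifting a forest back.

  module Contraction (I : Problem) {e₀ : Fin M} {u v : Node n}
    (joins : Joins (Problem.h I) (Problem.l I) e₀ u v) (v≢0 : v ≢ zero) (u≢v : u ≢ v)
    (c≡0 : Problem.c I e₀ ≡ 0ℚ) where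
    open Problem I

    φ : Node n → Node n
    φ x = if x ≡ᵇ v then u else x

    -- `v` remains as an isolated vertex whose cut constraints hold trivially by slack 1 and which
    -- has no penalty. A set containing the merged vertex pulls back to one containing both ends, so
    -- either slack is valid there; the minimum keeps the total penalty times slack from growing.
    π′ s′ : Node n → ℚ
    π′ x = if x ≡ᵇ v then 0ℚ else if x ≡ᵇ u then π u + π v else π x
    s′ x = if x ≡ᵇ v then 1ℚ else if x ≡ᵇ u then s u ⊓ s v else s x

    φ-v : φ v ≡ u
    φ-v rewrite ≡ᵇ-refl v = refl

    φ-≢ : ∀ {x} → x ≢ v → φ x ≡ x
    φ-≢ x≢v rewrite ≢⇒≡ᵇ-false x≢v = refl

    φ≢v : ∀ x → φ x ≢ v
    φ≢v x with x Fin.≟ v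
    ... | yes _  = u≢v
    ... | no x≢v = x≢v

    π′-u : π′ u ≡ π u + π v
    π′-u rewrite ≢⇒≡ᵇ-false u≢v | ≡ᵇ-refl u = refl

    π′-≢ : ∀ {x} → x ≢ v → x ≢ u → π′ x ≡ π x
    π′-≢ x≢v x≢u rewrite ≢⇒≡ᵇ-false x≢v | ≢⇒≡ᵇ-false x≢u = refl

    cut′ : ∀ S x → S zero ≡ false → S x ≡ true → 1ℚ ≤ cutWeight (φ ∘ h) (φ ∘ l) S + s′ x
    cut′ S x S0 Sx with x Fin.≟ v
    ... | yes _ = ≤-by _ (∑-nonNeg λ e → if-nonNeg (S (φ (h e)) xor S (φ (l e))) (0≤z e))
                    (ℚ.+-comm (cutWeight (φ ∘ h) (φ ∘ l) S) 1ℚ)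
    ... | no x≢v with x Fin.≟ u
    ...   | no _ = cut (S ∘ φ) x (trans (cong S (φ-≢ (v≢0 ∘ sym))) S0) (trans (cong S (φ-≢ x≢v)) Sx)
    ...   | yes refl = [ at (s u) (cut-at u (trans (cong S (φ-≢ u≢v)) Sx))
                       , at (s v) (cut-at v (trans (cong S φ-v) Sx)) ]′ (ℚ.⊓-sel (s u) (s v))
      where
      cut-at : ∀ y → S (φ y) ≡ true → 1ℚ ≤ cutWeight (φ ∘ h) (φ ∘ l) S + s y
      cut-at y = cut (S ∘ φ) y (trans (cong S (φ-≢ (v≢0 ∘ sym))) S0)
      at : ∀ p → 1ℚ ≤ cutWeight (φ ∘ h) (φ ∘ l) S + p → s u ⊓ s v ≡ p →
           1ℚ ≤ cutWeight (φ ∘ h) (φ ∘ l) S + (s u ⊓ s v)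
      at p le refl = le

    contracted : Problem
    contracted = record
      { h = φ ∘ h ; l = φ ∘ l ; c = c ; π = π′ ; s = s′ ; 0≤c = 0≤c ; 0≤π = 0≤π′ ; 0≤s = 0≤s′ ; cut =
          cut′ }
      where
      0≤π′ : ∀ x → 0ℚ ≤ π′ x
      0≤π′ x with x Fin.≟ v
      ... | yes _ = ℚ.≤-refl
      ... | no _ with x Fin.≟ u
      ...   | yes _ = 0≤π u 0≤+ 0≤π v
      ...   | no _  = 0≤π x
      0≤s′ : ∀ x → 0ℚ ≤ s′ x
      0≤s′ x with x Fin.≟ v
      ... | yes _ = 0≤1
      ... | no _ with x Fin.≟ u
      ...   | yes _ = ℚ.⊓-glb (0≤s u) (0≤s v)
      ...   | no _  = 0≤s x

    ∑π≤∑π′ : ∑ℚ π ≤ ∑ℚ π′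
    ∑π≤∑π′ = ∑-transfer u v (π v) π′ π pointwise
      where
      pointwise : ∀ x → π x + (if u ≡ᵇ x then π v else 0ℚ) ≤ π′ x + (if v ≡ᵇ x then π v else 0ℚ)
      pointwise x with x Fin.≟ v
      ... | yes refl rewrite ≢⇒≡ᵇ-false u≢v | ≡ᵇ-refl v = ℚ.≤-reflexive (ℚ.+-comm (π v) 0ℚ)
      ... | no x≢v with x Fin.≟ u
      ...   | yes refl rewrite ≡ᵇ-refl u | ≢⇒≡ᵇ-false (u≢v ∘ sym) =
          ℚ.≤-reflexive (sym (ℚ.+-identityʳ (π u + π v)))
      ...   | no x≢u rewrite ≢⇒≡ᵇ-false (x≢u ∘ sym) | ≢⇒≡ᵇ-false (x≢v ∘ sym) = ℚ.≤-refl

    ∑π′s′≤∑πs : ∑ℚ (λ x → π′ x * s′ x) ≤ ∑ℚ (λ x → π x * s x)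
    ∑π′s′≤∑πs = ∑-transfer v u (π v * s v) (λ x → π x * s x) (λ x → π′ x * s′ x) pointwise
      where
      pointwise : ∀ x → π′ x * s′ x + (if v ≡ᵇ x then π v * s v else 0ℚ) ≤
                        π x * s x + (if u ≡ᵇ x then π v * s v else 0ℚ)
      pointwise x with x Fin.≟ v
      ... | yes refl rewrite ≢⇒≡ᵇ-false u≢v | ≡ᵇ-refl v =
        ℚ.≤-reflexive (solve 1 (λ p → con 0ℚ :* con 1ℚ :+ p := p :+ con 0ℚ) refl (π v * s v))
      ... | no x≢v with x Fin.≟ u
      ...   | yes refl rewrite ≡ᵇ-refl u | ≢⇒≡ᵇ-false (u≢v ∘ sym) =
        ≤-by _ (0≤π u 0≤* 0≤q-p (ℚ.p⊓q≤p (s u) (s v)) 0≤+ 0≤π v 0≤* 0≤q-p (ℚ.p⊓q≤q (s u) (s v)))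
          (solve 5 (λ a b x y m → a :* x :+ b :* y :=
            (a :+ b) :* m :+ con 0ℚ :+ (a :* (x :- m) :+ b :* (y :- m))) refl (π u) (π v) (s u) (s v)
                (s u ⊓ s v))
      ...   | no x≢u rewrite ≢⇒≡ᵇ-false (x≢u ∘ sym) | ≢⇒≡ᵇ-false (x≢v ∘ sym) = ℚ.≤-refl

    -- A forest hanging on p in the contracted graph comes apart into one hanging
    -- on p and, if p is u, one hanging on v.
    record Split (p : Node n) (t : Forest (Node n) (Fin M)) : Set where
      field
        at-p at-v : Forest (Node n) (Fin M)
        hangs-p   : HangsOn h l p at-p
        hangs-v   : HangsOn h l v at-v
        leaves-p  : PositiveLeaves π at-p
        leaves-v  : PositiveLeaves π at-v
        only-u    : p ≢ u → at-v ≡ []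
        cost≡     : cost c at-p + cost c at-v ≡ cost c t
        weight≡   : weight π at-p + weight π at-v ≡ weight π′ t
        occurs≤   : ∀ y → occurs y at-p ℕ.+ occurs y at-v ℕ.≤ occurs (φ y) t
        nonempty  : at-p ≡ [] → at-v ≡ [] → t ≡ []

    -- The subforest below x̂, a preimage under φ of a vertex x that has the
    -- subforest t below it.
    record Block (x x̂ : Node n) (t : Forest (Node n) (Fin M)) : Set where
      field
        below   : Forest (Node n) (Fin M)
        hangs   : HangsOn h l x̂ below
        leaves  : PositiveLeaves π below
        leaf    : (t ≡ [] → 0ℚ < π′ x) → below ≡ [] → 0ℚ < π x̂
        cost≡   : cost c below ≡ cost c t
        weight≡ : π x̂ + weight π below ≡ π′ x + weight π′ t
        occurs≤ : ∀ y → (if y ≡ᵇ x̂ then 1 else 0) ℕ.+ occurs y below ℕ.≤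
                        (if φ y ≡ᵇ x then 1 else 0) ℕ.+ occurs (φ y) t

    π≡0 : ∀ x → ¬ 0ℚ < π x → π x ≡ 0ℚ
    π≡0 x π≯0 = ℚ.≤-antisym (ℚ.≮⇒≥ π≯0) (0≤π x)

    φ-indicator : ∀ y {x̂ x} → φ x̂ ≡ x → (if y ≡ᵇ x̂ then 1 else 0) ℕ.≤ (if φ y ≡ᵇ x then 1 else 0)
    φ-indicator y {x̂} refl with y Fin.≟ x̂
    ... | no _     = z≤n
    ... | yes refl rewrite ≡ᵇ-refl (φ y) = ℕ.≤-refl

    φ-indicator₂ : ∀ y → (if y ≡ᵇ u then 1 else 0) ℕ.+ (if y ≡ᵇ v then 1 else 0)
        ℕ.≤ (if φ y ≡ᵇ u then 1 else 0)
    φ-indicator₂ y with y Fin.≟ v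
    ... | yes refl rewrite ≢⇒≡ᵇ-false (u≢v ∘ sym) | ≡ᵇ-refl u = ℕ.≤-refl
    ... | no _ = ℕ.≤-reflexive (ℕ.+-identityʳ _)

    -- The forest enters `x` through `x̂`. If `x` is `u`, the free edge `e₀` can hang the other end,
    -- with its share of the forest, below `x̂`; hence `u` must not be the root when `x̂` is `v`. An
    -- other end that would become a leaf without penalty is left out, as in the reverse deletion of
    -- Goemans and Williamson.
    block : ∀ x x̂ t → φ x̂ ≡ x → (x̂ ≡ v → u ≢ zero) → Split x t → Block x x̂ t
    block x x̂ t φx̂ v→u≢0 S = preimage (x̂ Fin.≟ v)
     where
     same : x̂ ≢ v → φ x̂ ≡ x → Block x x̂ t
     same x̂≢v φx̂ with refl ← trans (sym φx̂) (φ-≢ x̂≢v) = split-at-u (x Fin.≟ u)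
      where
      open Split S
      alone : at-v ≡ [] → (π′ x ≡ π x) → Block x x t
      alone none π≡ = record
        { below = at-p ; hangs = hangs-p ; leaves = leaves-p
        ; leaf = λ pos at-p≡[] → subst (0ℚ <_) π≡ (pos (nonempty at-p≡[] none))
        ; cost≡ = trans (sym (trans (cong (λ t → cost c at-p + cost c t) none) (ℚ.+-identityʳ _))) cost≡
        ; weight≡ = cong₂ _+_ (sym π≡) (trans
            (sym (trans (cong (λ t → weight π at-p + weight π t) none) (ℚ.+-identityʳ _))) weight≡)
        ; occurs≤ = λ y → ℕ.+-mono-≤ (φ-indicator y φx̂) (ℕ.≤-trans (ℕ.m≤m+n _ _) (occurs≤ y)) }
      split-at-u : Dec (x ≡ u) → Block x x t
      split-at-u (no x≢u) = alone (only-u x≢u) (π′-≢ x̂≢v x≢u)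
      split-at-u (yes refl) = prune at-v refl (0ℚ ℚ.<? π v)
        where
        whole : (at-v ≡ [] → 0ℚ < π v) → Block u u t
        whole lf = record
          { below = node v e₀ at-v at-p ; hangs = v≢0 , joins , hangs-v , hangs-p
          ; leaves = lf , leaves-v , leaves-p
          ; leaf = λ _ ()
          ; cost≡ = trans (cong (λ k → k + (cost c at-v + cost c at-p)) c≡0)
              (trans (ℚ.+-identityˡ _) (trans (ℚ.+-comm (cost c at-v) (cost c at-p)) cost≡))
          ; weight≡ = trans (solve 4 (λ a b x y → a :+ (b :+ (x :+ y)) := (a :+ b) :+ (y :+ x)) refl
              (π u) (π v) (weight π at-v) (weight π at-p))
              (cong₂ _+_ (sym π′-u) weight≡)
          ; occurs≤ = λ y → ℕ.≤-trans
              (ℕ.≤-reflexive (trans (sym (ℕ.+-assoc (if y ≡ᵇ u then 1 else 0)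
                  (if y ≡ᵇ v then 1 else 0) _))
                (cong ((if y ≡ᵇ u then 1 else 0) ℕ.+ (if y ≡ᵇ v then 1 else 0) ℕ.+_)
                    (ℕ.+-comm (occurs y at-v) (occurs y at-p)))))
              (ℕ.+-mono-≤ (φ-indicator₂ y) (occurs≤ y)) }
        -- If `v` is omitted, its penalty is 0, so the collected weight does not change.
        prune : ∀ t′ → at-v ≡ t′ → Dec (0ℚ < π v) → Block u u t
        prune _ _ (yes 0<π) = whole λ _ → 0<π
        prune [] eq (no π≯0) = alone eq
            (trans π′-u (trans (cong (π u +_) (π≡0 v π≯0)) (ℚ.+-identityʳ (π u))))
        prune (node _ _ _ _) eq (no _) = whole λ eq′ → contradiction (trans (sym eq) eq′) λ ()
     -- Here the merged vertex is entered through `v`, and `u` becomes the child; the two parts of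
     -- the split exchange their roles.
     other : φ v ≡ x → u ≢ zero → Block x v t
     other φv u≢0 with refl ← trans (sym φv) φ-v = prune at-p refl (0ℚ ℚ.<? π u)
      where
      open Split S
      whole : (at-p ≡ [] → 0ℚ < π u) → Block u v t
      whole lf = record
        { below = node u e₀ at-p at-v ; hangs = u≢0 , swap joins , hangs-p , hangs-v
        ; leaves = lf , leaves-p , leaves-v
        ; leaf = λ _ ()
        ; cost≡ = trans (cong (λ k → k + (cost c at-p + cost c at-v)) c≡0)
            (trans (ℚ.+-identityˡ _) cost≡)
        ; weight≡ = trans (solve 4 (λ a b x y → b :+ (a :+ (y :+ x)) := (a :+ b) :+ (y :+ x)) refl
            (π u) (π v) (weight π at-v) (weight π at-p))
            (cong₂ _+_ (sym π′-u) weight≡)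
        ; occurs≤ = λ y → ℕ.≤-trans
            (ℕ.≤-reflexive (trans (sym (ℕ.+-assoc (if y ≡ᵇ v then 1 else 0) (if y ≡ᵇ u then 1 else 0) _))
              (cong (ℕ._+ (occurs y at-p ℕ.+ occurs y at-v)) (ℕ.+-comm (if y ≡ᵇ v then 1 else 0)
                  (if y ≡ᵇ u then 1 else 0)))))
            (ℕ.+-mono-≤ (φ-indicator₂ y) (occurs≤ y)) }
      prune : ∀ t′ → at-p ≡ t′ → Dec (0ℚ < π u) → Block u v t
      prune _ _ (yes 0<π) = whole λ _ → 0<π
      prune (node _ _ _ _) eq (no _) = whole λ eq′ → contradiction (trans (sym eq) eq′) λ ()
      prune [] none (no π≯0) = record
        { below = at-v ; hangs = hangs-v ; leaves = leaves-v
        ; leaf = λ pos at-v≡[] → subst (0ℚ <_) π≡ (pos (nonempty none at-v≡[]))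
        ; cost≡ = trans (sym (trans (cong (λ t → cost c t + cost c at-v) none) (ℚ.+-identityˡ _))) cost≡
        ; weight≡ = cong₂ _+_ (sym π≡) (trans
            (sym (trans (cong (λ t → weight π t + weight π at-v) none) (ℚ.+-identityˡ _))) weight≡)
        ; occurs≤ = λ y → ℕ.+-mono-≤ (φ-indicator y φ-v) (ℕ.≤-trans (ℕ.m≤n+m _ _) (occurs≤ y)) }
        where
        π≡ : π′ u ≡ π v
        π≡ = trans π′-u (trans (cong (_+ π v) (π≡0 u π≯0)) (ℚ.+-identityˡ (π v)))
     preimage : Dec (x̂ ≡ v) → Block x x̂ t
     preimage (no x̂≢v) = same x̂≢v φx̂
     preimage (yes refl) = other φx̂ (v→u≢0 refl)

    lift : ∀ {e p x} → Joins (φ ∘ h) (φ ∘ l) e p x → ∃[ p̂ ] ∃[ x̂ ] φ p̂ ≡ p × φ x̂ ≡ x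
        × Joins h l e p̂ x̂
    lift {e} (inj₁ (eq , eq′)) = h e , l e , eq , eq′ , inj₁ (refl , refl)
    lift {e} (inj₂ (eq , eq′)) = l e , h e , eq′ , eq , inj₂ (refl , refl)

    -- An edge keeps its index under contraction, so its original ends tell whether a tree belongs
    -- at `p` or at `v`, and through which preimage it enters its top vertex.
    split : ∀ p t → p ≢ v → HangsOn (φ ∘ h) (φ ∘ l) p t → PositiveLeaves π′ t → Split p t
    split p [] _ _ _ = record
      { at-p = [] ; at-v = [] ; hangs-p = tt ; hangs-v = tt ; leaves-p = tt ; leaves-v = tt
      ; only-u = λ _ → refl ; cost≡ = refl ; weight≡ = refl ; occurs≤ = λ _ → z≤n ; nonempty =
          λ _ _ → refl }
    split p (node x e ks ss) p≢v (x≢0 , j , hk , hs) (lf , lk , ls)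
      with lift j
    ... | p̂ , x̂ , φp̂ , φx̂ , ĵ = place (p̂ Fin.≟ v)
      where
      x≢v : x ≢ v
      x≢v x≡v = φ≢v x̂ (trans φx̂ x≡v)
      x̂≢0 : x̂ ≢ zero
      x̂≢0 refl = x≢0 (trans (sym φx̂) (φ-≢ (v≢0 ∘ sym)))
      B : Block x x̂ ks
      B = block x x̂ ks φx̂ (λ { refl u≡0 → x≢0 (trans (trans (sym φx̂) φ-v) u≡0) })
          (split x ks x≢v hk lk)
      module B = Block B
      module S = Split (split p ss p≢v hs ls)
      occurs-node : ∀ y {k} →
        k ≡ ((if y ≡ᵇ x̂ then 1 else 0) ℕ.+ occurs y B.below) ℕ.+ (occurs y S.at-p ℕ.+ occurs y S.at-v) →
        k ℕ.≤ occurs (φ y) (node x e ks ss)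
      occurs-node y refl = ℕ.≤-trans (ℕ.+-mono-≤ (B.occurs≤ y) (S.occurs≤ y))
        (ℕ.≤-reflexive (ℕ.+-assoc (if φ y ≡ᵇ x then 1 else 0) (occurs (φ y) ks) (occurs (φ y) ss)))
      place : Dec (p̂ ≡ v) → Split p (node x e ks ss)
      place (no p̂≢v) with refl ← trans (sym φp̂) (φ-≢ p̂≢v) = record
        { at-p = node x̂ e B.below S.at-p ; at-v = S.at-v
        ; hangs-p = x̂≢0 , ĵ , B.hangs , S.hangs-p ; hangs-v = S.hangs-v
        ; leaves-p = B.leaf lf , B.leaves , S.leaves-p ; leaves-v = S.leaves-v
        ; only-u = S.only-u
        ; cost≡ = trans (solve 4 (λ a b x y → (a :+ (b :+ x)) :+ y := a :+ (b :+ (x :+ y))) refl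
            (c e) (cost c B.below) (cost c S.at-p) (cost c S.at-v))
            (cong₂ (λ a b → c e + (a + b)) B.cost≡ S.cost≡)
        ; weight≡ = trans (solve 4 (λ a b x y → (a :+ (b :+ x)) :+ y := (a :+ b) :+ (x :+ y)) refl
            (π x̂) (weight π B.below) (weight π S.at-p) (weight π S.at-v))
            (trans (cong₂ _+_ B.weight≡ S.weight≡) (ℚ.+-assoc (π′ x) (weight π′ ks) (weight π′ ss)))
        ; occurs≤ = λ y → occurs-node y (ℕS.solve 4 (λ a b x y → (a ℕS.:+ (b ℕS.:+ x)) ℕS.:+ y ℕS.:=
            (a ℕS.:+ b) ℕS.:+ (x ℕS.:+ y)) refl (if y ≡ᵇ x̂ then 1 else 0) (occurs y B.below)
            (occurs y S.at-p) (occurs y S.at-v))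
        ; nonempty = λ () }
      place (yes refl) with refl ← trans (sym φp̂) φ-v = record
        { at-p = S.at-p ; at-v = node x̂ e B.below S.at-v
        ; hangs-v = x̂≢0 , ĵ , B.hangs , S.hangs-v ; hangs-p = S.hangs-p
        ; leaves-v = B.leaf lf , B.leaves , S.leaves-v ; leaves-p = S.leaves-p
        ; only-u = contradiction refl
        ; cost≡ = trans (solve 4 (λ a b x y → x :+ (a :+ (b :+ y)) := a :+ (b :+ (x :+ y))) refl
            (c e) (cost c B.below) (cost c S.at-p) (cost c S.at-v))
            (cong₂ (λ a b → c e + (a + b)) B.cost≡ S.cost≡)
        ; weight≡ = trans (solve 4 (λ a b x y → x :+ (a :+ (b :+ y)) := (a :+ b) :+ (x :+ y)) refl
            (π x̂) (weight π B.below) (weight π S.at-p) (weight π S.at-v))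
            (trans (cong₂ _+_ B.weight≡ S.weight≡) (ℚ.+-assoc (π′ x) (weight π′ ks) (weight π′ ss)))
        ; occurs≤ = λ y → occurs-node y (ℕS.solve 4 (λ a b x y → x ℕS.:+ (a ℕS.:+ (b ℕS.:+ y)) ℕS.:=
            (a ℕS.:+ b) ℕS.:+ (x ℕS.:+ y)) refl (if y ≡ᵇ x̂ then 1 else 0) (occurs y B.below)
            (occurs y S.at-p) (occurs y S.at-v))
        ; nonempty = λ _ () }

    expand : Solution contracted → Solution I
    expand (t , hangs , leaves , occ , bound) = B.below , B.hangs , B.leaves ,
      (λ y → ℕ.≤-trans (ℕ.m≤n+m _ _) (ℕ.≤-trans (B.occurs≤ y) (occurs≤1 (φ y)))) ,
      subst₂ (λ C D → C + 2ℚ * ∑ℚ π ≤ 2ℚ * (∑ℚ (λ e → z e * c e) + ∑ℚ (λ x → π x * s x)) + 2ℚ * D)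
        (sym B.cost≡) (sym B.weight≡)
        (≤-by _ (0≤q-p bound 0≤+ 0≤2 0≤* (0≤q-p ∑π≤∑π′ 0≤+ 0≤q-p ∑π′s′≤∑πs))
          (solve 7 (λ C P P′ Z Q Q′ D → con 2ℚ :* (Z :+ Q) :+ con 2ℚ :* D :=
              C :+ con 2ℚ :* P :+ ((con 2ℚ :* (Z :+ Q′) :+ con 2ℚ :* D :- (C :+ con 2ℚ :* P′)) :+
                con 2ℚ :* ((P′ :- P) :+ (Q :- Q′))))
            refl (cost c t) (∑ℚ π) (∑ℚ π′) (∑ℚ (λ e → z e * c e)) (∑ℚ (λ x → π x * s x))
              (∑ℚ (λ x → π′ x * s′ x)) (π′ zero + weight π′ t)))
      where
      B : Block zero zero t
      B = block zero zero t (φ-≢ (v≢0 ∘ sym)) (λ 0≡v → contradiction (sym 0≡v) v≢0)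
          (split zero t (v≢0 ∘ sym) hangs leaves)
      module B = Block B
      -- A vertex merged into the root is counted by the indicator alone, because the root itself
      -- never occurs in `t`.
      occurs≤1 : ∀ y → (if y ≡ᵇ zero then 1 else 0) ℕ.+ occurs y t ℕ.≤ 1
      occurs≤1 zero    = ℕ.≤-reflexive (cong suc (occurs-root t hangs))
      occurs≤1 (suc y) = occ (suc y)

  -- The local ratio induction.

  open Problem
  open Active

  -- With `actives` this gives a lexicographic measure: contraction turns a non-loop into a loop,
  -- whatever it does to the active vertices, and using up a penalty leaves the ends of all edges
  -- alone.
  links : (h l : Fin M → Node n) → ℕ
  links h l = ∑ℕ λ e → if h e ≡ᵇ l e then 0 else 1

  actives : Problem → ℕ
  actives I = ∑ℕ λ v → if active I v then 1 else 0

  links-φ : ∀ (h l : Fin M → Node n) (φ : Node n → Node n) e → h e ≢ l e → φ (h e) ≡ φ (l e) →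
            links (φ ∘ h) (φ ∘ l) ℕ.< links h l
  links-φ h l φ e₀ h≢l φh≡φl = ∑ℕ-mono-< pointwise e₀ strict
    where
    pointwise : ∀ e → (if φ (h e) ≡ᵇ φ (l e) then 0 else 1) ℕ.≤ (if h e ≡ᵇ l e then 0 else 1)
    pointwise e with h e Fin.≟ l e
    ... | yes eq rewrite eq | ≡ᵇ-refl (φ (l e)) = z≤n
    ... | no _ with φ (h e) ≡ᵇ φ (l e)
    ...   | true  = z≤n
    ...   | false = ℕ.≤-refl
    strict : (if φ (h e₀) ≡ᵇ φ (l e₀) then 0 else 1) ℕ.< (if h e₀ ≡ᵇ l e₀ then 0 else 1)
    strict rewrite ≢⇒≡ᵇ-false h≢l | φh≡φl | ≡ᵇ-refl (φ (l e₀)) = ℕ.≤-refl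

  contract : ∀ I e → h I e ≢ l I e → c I e ≡ 0ℚ →
             (∀ I′ → links (h I′) (l I′) ℕ.< links (h I) (l I) → Solution I′) → Solution I
  contract I e h≢l c≡0 solve-smaller with l I e Fin.≟ zero
  ... | no l≢0 = C.expand (solve-smaller C.contracted
                   (links-φ (h I) (l I) C.φ e h≢l (trans (C.φ-≢ h≢l) (sym C.φ-v))))
    where module C = Contraction I {e} (inj₁ (refl , refl)) l≢0 h≢l c≡0
  ... | yes l≡0 = C.expand (solve-smaller C.contracted
                    (links-φ (h I) (l I) C.φ e h≢l (trans C.φ-v (sym (C.φ-≢ (h≢l ∘ sym))))))
    where
    h≢0 : h I e ≢ zero
    h≢0 h≡0 = h≢l (trans h≡0 (sym l≡0))
    module C = Contraction I {e} (inj₂ (refl , refl)) h≢0 (h≢l ∘ sym) c≡0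

  inactive : ∀ I → (∀ v → α I v ≡ 0ℚ) → Solution I
  inactive I α≡0 = [] , tt , tt , (λ _ → z≤n) ,
    ≤-by _ (0≤2 0≤* (∑-nonNeg (λ e → 0≤z e 0≤* 0≤c I e) 0≤+ ∑-nonNeg (λ v → 0≤π I v 0≤* 0≤s I v)))
      (trans (solve 3 (λ p Z Q → con 2ℚ :* (Z :+ Q) :+ con 2ℚ :* (p :+ con 0ℚ) := con 0ℚ :+ con 2ℚ :* p
          :+ con 2ℚ :* (Z :+ Q))
               refl (π I zero) (∑ℚ (λ e → z e * c I e)) (∑ℚ (λ v → π I v * s I v)))
             (cong (λ p → 0ℚ + 2ℚ * p + 2ℚ * (∑ℚ (λ e → z e * c I e) + ∑ℚ (λ v → π I v * s I v)))
                 (sym ∑π≡)))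
    where
    ∑π≡ : ∑ℚ (π I) ≡ π I zero
    ∑π≡ = trans (∑-cong only-root) (∑-indicator zero (π I))
      where
      only-root : ∀ v → π I v ≡ (if zero ≡ᵇ v then π I v else 0ℚ)
      only-root zero    = refl
      only-root (suc v) = ℚ.≤-antisym (ℚ.≮⇒≥ λ 0<π →
        ℚ.1≢0 (trans (sym (α-active I (suc v) (λ ()) 0<π)) (α≡0 (suc v)))) (0≤π I (suc v))

  -- The unit costs κ and penalties α satisfy the required bound by themselves for
  -- every forest that avoids inactive leaves. They are subtracted until an edge
  -- becomes free, which is then contracted, or a penalty is used up.
  reduce : ∀ I →
    (∀ I′ → links (h I′) (l I′) ℕ.< links (h I) (l I) → Solution I′) →
    (∀ I′ → links (h I′) (l I′) ≡ links (h I) (l I) → actives I′ ℕ.< actives I → Solution I′) →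
    Solution I
  reduce I fewer-links fewer-actives =
    [ (λ none → inactive I λ v → trans (cong [ α I , κ I ]′ (sym (Fin.splitAt-↑ˡ (suc n) v M)))
        (none (v ↑ˡ M)))
    , step ]′
    (max-step rate slack (λ i → nonNeg-rate (splitAt (suc n) i)) (λ i →
        nonNeg-slack (splitAt (suc n) i)))
    where
    -- Penalties and costs form one family, so that a single step finds whichever becomes tight
    -- first.
    rate slack : Fin (suc n ℕ.+ M) → ℚ
    rate  = [ α I , κ I ]′ ∘ splitAt (suc n)
    slack = [ π I , c I ]′ ∘ splitAt (suc n)
    nonNeg-rate : ∀ i → 0ℚ ≤ [ α I , κ I ]′ i
    nonNeg-rate (inj₁ v) = 0≤α I v
    nonNeg-rate (inj₂ e) = 0≤κ I e
    nonNeg-slack : ∀ i → 0ℚ ≤ [ π I , c I ]′ i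
    nonNeg-slack (inj₁ v) = 0≤π I v
    nonNeg-slack (inj₂ e) = 0≤c I e
    step : ∃[ ε ] 0ℚ ≤ ε × (∀ i → ε * rate i ≤ slack i) × ∃[ i ] 0ℚ < rate i × ε * rate i ≡ slack i →
           Solution I
    step (ε , 0≤ε , fits , i , 0<rate , tight) =
      raise I ε 0≤ε εκ≤c εα≤π (tight-at (splitAt (suc n) i) 0<rate tight)
      where
      εκ≤c : ∀ e → ε * κ I e ≤ c I e
      εκ≤c e = subst (λ s → ε * [ α I , κ I ]′ s ≤ [ π I , c I ]′ s) (Fin.splitAt-↑ʳ (suc n) M e)
          (fits (suc n ↑ʳ e))
      εα≤π : ∀ v → ε * α I v ≤ π I v
      εα≤π v = subst (λ s → ε * [ α I , κ I ]′ s ≤ [ π I , c I ]′ s) (Fin.splitAt-↑ˡ (suc n) v M)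
          (fits (v ↑ˡ M))
      I′ : Problem
      I′ = lowered I ε 0≤ε εκ≤c εα≤π
      tight-at : ∀ s → 0ℚ < [ α I , κ I ]′ s → ε * [ α I , κ I ]′ s ≡ [ π I , c I ]′ s → Solution I′
      -- A positive rate excludes loops, so this edge can be contracted.
      tight-at (inj₂ e) 0<κ εκ≡c = contract I′ e
        (λ h≡l → ℚ.<-irrefl (sym (κ-loop I e h≡l)) 0<κ)
        (trans (cong (λ p → c I e - p) εκ≡c) (ℚ.+-inverseʳ (c I e)))
        fewer-links
      tight-at (inj₁ v) 0<α εα≡π = fewer-actives I′ refl (∑ℕ-mono-< fewer v one-less)
        where
        fewer : ∀ w → (if active I′ w then 1 else 0) ℕ.≤ (if active I w then 1 else 0)
        fewer w = count-mono (active I′ w) (active I w) λ on →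
          let w≢0 , 0<π = active⁻ I′ w on in
          active⁺ I w w≢0 (ℚ.<-≤-trans 0<π (lowered-π≤ I ε 0≤ε εκ≤c εα≤π w))
        one-less : (if active I′ v then 1 else 0) ℕ.< (if active I v then 1 else 0)
        one-less = count-mono-< (active I′ v) (active I v)
          (λ on → contradiction (proj₂ (active⁻ I′ v on))
            (ℚ.<-irrefl (sym (trans (cong (λ p → π I v - p) εα≡π) (ℚ.+-inverseʳ (π I v))))))
          (positive-𝟙 (active I v) 0<α)

  solvable-below : ∀ k m I → links (h I) (l I) ℕ.< k → actives I ℕ.< m → Solution I
  solvable-below (suc k) (suc m) I (s≤s links≤k) (s≤s actives≤m) = reduce I
    (λ I′ links< → solvable-below k (suc (actives I′)) I′ (ℕ.<-≤-trans links< links≤k) ℕ.≤-refl)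
    (λ I′ links≡ actives< → solvable-below (suc k) m I′
      (s≤s (ℕ.≤-trans (ℕ.≤-reflexive links≡) links≤k)) (ℕ.<-≤-trans actives< actives≤m))

  solvable : ∀ I → Solution I
  solvable I = solvable-below (suc (links (h I) (l I))) (suc (actives I)) I ℕ.≤-refl ℕ.≤-refl

-- Lists of nodes and their multiplicities.

∣_∣ₗ : ∀ {A : Set} → List A → ℚ
∣ xs ∣ₗ = ℕ→ℚ (length xs)

count : ∀ {n} → Fin n → List (Fin n) → ℕ
count x []       = 0
count x (y ∷ xs) = (if x ≡ᵇ y then 1 else 0) ℕ.+ count x xs

count-++ : ∀ {n} (x : Fin n) xs ys → count x (xs ++ ys) ≡ count x xs ℕ.+ count x ys
count-++ x []       ys = refl
count-++ x (y ∷ xs) ys = trans (cong ((if x ≡ᵇ y then 1 else 0) ℕ.+_) (count-++ x xs ys))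
                               (sym (ℕ.+-assoc (if x ≡ᵇ y then 1 else 0) _ _))

count-reverse : ∀ {n} (x : Fin n) xs → count x (reverse xs) ≡ count x xs
count-reverse x []       = refl
count-reverse x (y ∷ xs) = begin
  count x (reverse (y ∷ xs))                           ≡⟨ cong (count x) (List.unfold-reverse y xs) ⟩
  count x (reverse xs ++ y ∷ [])                       ≡⟨ count-++ x (reverse xs) (y ∷ []) ⟩
  count x (reverse xs) ℕ.+ count x (y ∷ [])            ≡⟨ cong₂ ℕ._+_ (count-reverse x xs)
      (ℕ.+-identityʳ _) ⟩
  count x xs ℕ.+ (if x ≡ᵇ y then 1 else 0)             ≡⟨ ℕ.+-comm (count x xs) _ ⟩
  count x (y ∷ xs)                                     ∎
  where open ≡-Reasoning

count-filter : ∀ {n} (R : Fin n → Bool) x xs → count x (filterᵇ R xs) ≡ (if R x then count x xs else 0)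
count-filter R x [] with R x
... | true  = refl
... | false = refl
count-filter R x (y ∷ xs) with R y in Ry | x Fin.≟ y | count-filter R x xs
... | true  | yes refl | ih rewrite Ry | ≡ᵇ-refl y = cong suc ih
... | false | yes refl | ih rewrite Ry = ih
... | true  | no x≢y   | ih rewrite ≢⇒≡ᵇ-false x≢y = ih
... | false | no _     | ih = ih

∑ℕ-cong : ∀ {n} {f g : Fin n → ℕ} → (∀ i → f i ≡ g i) → ∑ℕ f ≡ ∑ℕ g
∑ℕ-cong {zero}  f≡g = refl
∑ℕ-cong {suc n} f≡g = cong₂ ℕ._+_ (f≡g zero) (∑ℕ-cong (f≡g ∘ suc))

∑ℕ-+ : ∀ {n} (f g : Fin n → ℕ) → ∑ℕ (λ i → f i ℕ.+ g i) ≡ ∑ℕ f ℕ.+ ∑ℕ g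
∑ℕ-+ = Sum.∑-distrib-+ ℕ.+-0-commutativeMonoid

∑ℕ-zero : ∀ n → ∑ℕ {n} (λ _ → 0) ≡ 0
∑ℕ-zero zero    = refl
∑ℕ-zero (suc n) = ∑ℕ-zero n

∑ℕ-const-1 : ∀ n → ∑ℕ {n} (λ _ → 1) ≡ n
∑ℕ-const-1 zero    = refl
∑ℕ-const-1 (suc n) = cong suc (∑ℕ-const-1 n)

∑ℕ-indicator : ∀ {n} (x : Fin n) → ∑ℕ (λ v → if v ≡ᵇ x then 1 else 0) ≡ 1
∑ℕ-indicator {suc n} zero    = cong suc (∑ℕ-zero n)
∑ℕ-indicator {suc n} (suc x) = ∑ℕ-indicator x

∑ℕ≡0 : ∀ {n} (f : Fin n → ℕ) → ∑ℕ f ≡ 0 → ∀ i → f i ≡ 0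
∑ℕ≡0 f eq zero    = ℕ.m+n≡0⇒m≡0 (f zero) eq
∑ℕ≡0 f eq (suc i) = ∑ℕ≡0 (f ∘ suc) (ℕ.m+n≡0⇒n≡0 (f zero) eq) i

∑ℕ-count : ∀ {n} (xs : List (Fin n)) → ∑ℕ (λ x → count x xs) ≡ length xs
∑ℕ-count {n} []   = ∑ℕ-zero n
∑ℕ-count (y ∷ xs) = trans (∑ℕ-+ (λ x → if x ≡ᵇ y then 1 else 0) (λ x → count x xs))
                          (cong₂ ℕ._+_ (∑ℕ-indicator y) (∑ℕ-count xs))

#_ : ∀ {n} → (Fin n → Bool) → ℕ
# R = ∑ℕ λ x → if R x then 1 else 0

-- Multiplicities do not see the order, so a tour can be reversed or concatenated freely.
Enumerates : ∀ {n} → (Fin n → Bool) → List (Fin n) → Set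
Enumerates R xs = ∀ x → count x xs ≡ (if R x then 1 else 0)

length-enumerates : ∀ {n} (R : Fin n → Bool) xs → Enumerates R xs → length xs ≡ # R
length-enumerates R xs enum = trans (sym (∑ℕ-count xs)) (∑ℕ-cong enum)

_∖_ : ∀ {n} → (Fin n → Bool) → List (Fin n) → Fin n → Bool
(R ∖ xs) x = R x ∧ (count x xs ℕ.≡ᵇ 0)

∖-enumerates : ∀ {n} (R : Fin n → Bool) xs ys zs → (∀ x → count x xs ℕ.≤ 1) →
  (∀ x → count x ys ≡ count x (filterᵇ R xs)) → Enumerates (R ∖ xs) zs → Enumerates R (ys ++ zs)
∖-enumerates R xs ys zs once ys≡ enum x = trans (count-++ x ys zs)
  (trans (cong₂ ℕ._+_ (trans (ys≡ x) (count-filter R x xs)) (enum x)) (cases (R x) (count x xs)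
      (once x)))
  where
  cases : ∀ b k → k ℕ.≤ 1 →
          (if b then k else 0) ℕ.+ (if b ∧ (k ℕ.≡ᵇ 0) then 1 else 0) ≡ (if b then 1 else 0)
  cases true  zero          _ = refl
  cases true  (suc zero)    _ = refl
  cases true  (suc (suc k)) (s≤s ())
  cases false zero          _ = refl
  cases false (suc k)       _ = refl

-- The missed nodes of `R` and the nodes of the tour, inside `R` or not, are disjoint sets of
-- non-root nodes. This turns a bound on all nodes missed by a tour into one on those still of
-- interest.
∖-# : ∀ {n} (R : Node n → Bool) xs → R zero ≡ false → (∀ x → count x xs ℕ.≤ 1) → count zero xs ≡ 0 →
      # (R ∖ xs) ℕ.+ length xs ℕ.≤ n
∖-# {n} R xs R0 once no-root = ℕ.≤-trans
  (ℕ.≤-reflexive (trans (cong (# (R ∖ xs) ℕ.+_) (sym (∑ℕ-count xs)))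
    (sym (∑ℕ-+ (λ x → if (R ∖ xs) x then 1 else 0) (λ x → count x xs)))))
  (ℕ.≤-trans (ℕ.+-mono-≤ (ℕ.≤-reflexive at-root) (∑ℕ-mono λ x → cases (R (suc x)) (count (suc x) xs)
      (once (suc x))))
    (ℕ.≤-reflexive (∑ℕ-const-1 n)))
  where
  at-root : (if (R ∖ xs) zero then 1 else 0) ℕ.+ count zero xs ≡ 0
  at-root rewrite R0 = no-root
  cases : ∀ b k → k ℕ.≤ 1 → (if b ∧ (k ℕ.≡ᵇ 0) then 1 else 0) ℕ.+ k ℕ.≤ 1
  cases true  zero    _   = ℕ.≤-refl
  cases false zero    _   = z≤n
  cases true  (suc k) k≤1 = k≤1
  cases false (suc k) k≤1 = k≤1

preorder : ∀ {V E} → Forest V E → List V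
preorder []               = []
preorder (node v e ks ss) = v ∷ preorder ks ++ preorder ss

count-preorder : ∀ {n E} (x : Node n) (t : Forest (Node n) E) → count x (preorder t) ≡ occurs x t
count-preorder x []               = refl
count-preorder x (node v e ks ss) = cong ((if x ≡ᵇ v then 1 else 0) ℕ.+_)
  (trans (count-++ x (preorder ks) (preorder ss)) (cong₂ ℕ._+_ (count-preorder x ks)
      (count-preorder x ss)))

-- Lengths and waiting times of walks in a metric.

module Travel {n : ℕ} (d : Node n → Node n → ℚ) (0≤d : ∀ x y → 0ℚ ≤ d x y)
  (d-sym : ∀ x y → d x y ≡ d y x) (triangle : ∀ x y z → d x z ≤ d x y + d y z) where

  pathLength : Node n → List (Node n) → Node n → ℚ
  pathLength p []       q = d p q
  pathLength p (x ∷ xs) q = d p x + pathLength x xs q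

  -- The sum of latencies, arranged by legs: each leg is waited for by every node not yet reached.
  waiting : Node n → List (Node n) → ℚ
  waiting p []       = 0ℚ
  waiting p (x ∷ xs) = ∣ x ∷ xs ∣ₗ * d p x + waiting x xs

  0≤pathLength : ∀ p xs q → 0ℚ ≤ pathLength p xs q
  0≤pathLength p []       q = 0≤d p q
  0≤pathLength p (x ∷ xs) q = 0≤d p x 0≤+ 0≤pathLength x xs q

  pathLength-detour : ∀ p x xs q → pathLength p xs q ≤ d p x + pathLength x xs q
  pathLength-detour p x []       q = triangle p x q
  pathLength-detour p x (y ∷ xs) q = ≤-by _ (0≤q-p (triangle p x y))
    (solve 4 (λ a b c k → a :+ (b :+ k) := (c :+ k) :+ (a :+ b :- c)) refl (d p x) (d x y) (d p y)
        (pathLength y xs q))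

  pathLength-filter : ∀ (R : Node n → Bool) p xs q → pathLength p (filterᵇ R xs) q ≤ pathLength p xs q
  pathLength-filter R p []       q = ℚ.≤-refl
  pathLength-filter R p (x ∷ xs) q = cases (R x) refl
    where
    cases : ∀ b → R x ≡ b → pathLength p (filterᵇ R (x ∷ xs)) q ≤ d p x + pathLength x xs q
    cases true  eq rewrite eq = ℚ.+-monoʳ-≤ (d p x) (pathLength-filter R x xs q)
    cases false eq rewrite eq = ℚ.≤-trans (pathLength-detour p x (filterᵇ R xs) q)
                                  (ℚ.+-monoʳ-≤ (d p x) (pathLength-filter R x xs q))

  -- Depth-first traversal with shortcuts: going back to `p` after each subtree only lengthens the
  -- walk and uses every edge twice. The continuation `ys` carries the induction over siblings.
  pathLength-preorder : ∀ {E} (h l : E → Node n) p t ys q → HangsOn h l p t →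
    pathLength p (preorder t ++ ys) q ≤ 2ℚ * cost (λ e → d (h e) (l e)) t + pathLength p ys q
  pathLength-preorder h l p [] ys q _ =
    ℚ.≤-reflexive (solve 1 (λ a → a := con 2ℚ :* con 0ℚ :+ a) refl (pathLength p ys q))
  pathLength-preorder h l p (node v e ks ss) ys q (_ , j , hk , hs) = begin
    d p v + pathLength v ((preorder ks ++ preorder ss) ++ ys) q
      ≡⟨ cong (λ xs → d p v + pathLength v xs q) (List.++-assoc (preorder ks) (preorder ss) ys) ⟩
    d p v + pathLength v (preorder ks ++ preorder ss ++ ys) q
      ≤⟨ ℚ.+-monoʳ-≤ (d p v) (pathLength-preorder h l v ks (preorder ss ++ ys) q hk) ⟩
    d p v + (2ℚ * K + pathLength v (preorder ss ++ ys) q)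
      ≤⟨ ℚ.+-monoʳ-≤ (d p v) (ℚ.+-monoʳ-≤ (2ℚ * K) (pathLength-detour v p (preorder ss ++ ys) q)) ⟩
    d p v + (2ℚ * K + (d v p + pathLength p (preorder ss ++ ys) q))
      ≤⟨ ℚ.+-monoʳ-≤ (d p v) (ℚ.+-monoʳ-≤ (2ℚ * K) (ℚ.+-monoʳ-≤ (d v p)
           (pathLength-preorder h l p ss ys q hs))) ⟩
    d p v + (2ℚ * K + (d v p + (2ℚ * S + pathLength p ys q)))
      ≡⟨ cong₂ (λ a b → a + (2ℚ * K + (b + (2ℚ * S + pathLength p ys q)))) (edge-length j)
          (trans (d-sym v p) (edge-length j)) ⟩
    D + (2ℚ * K + (D + (2ℚ * S + pathLength p ys q)))
      ≡⟨ solve 4 (λ D K S y → D :+ (con 2ℚ :* K :+ (D :+ (con 2ℚ :* S :+ y))) := con 2ℚ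
          :* (D :+ (K :+ S)) :+ y)
           refl D K S (pathLength p ys q) ⟩
    2ℚ * (D + (K + S)) + pathLength p ys q ∎
    where
    open ℚ.≤-Reasoning
    D K S : ℚ
    D = d (h e) (l e)
    K = cost (λ e → d (h e) (l e)) ks
    S = cost (λ e → d (h e) (l e)) ss
    edge-length : Joins h l e p v → d p v ≡ D
    edge-length (inj₁ (refl , refl)) = refl
    edge-length (inj₂ (refl , refl)) = d-sym p v

  waiting-∷ : ∀ p x xs → waiting p (x ∷ xs) ≡ (1ℚ + ∣ xs ∣ₗ) * d p x + waiting x xs
  waiting-∷ p x xs = cong (λ k → k * d p x + waiting x xs) (ℕ→ℚ-suc (length xs))

  waiting-detour : ∀ p x ys → waiting p ys ≤ ∣ ys ∣ₗ * d p x + waiting x ys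
  waiting-detour p x []       = ℚ.≤-reflexive (solve 1 (λ a → con 0ℚ := con 0ℚ :* a :+ con 0ℚ) refl
      (d p x))
  waiting-detour p x (y ∷ ys) = ≤-by _ (ℕ→ℚ-nonNeg (suc (length ys)) 0≤* 0≤q-p (triangle p x y))
    (solve 5 (λ k a b c w → k :* a :+ (k :* b :+ w) := (k :* c :+ w) :+ k :* (a :+ b :- c))
      refl (ℕ→ℚ (suc (length ys))) (d p x) (d x y) (d p y) (waiting y ys))

  -- A stop at `r` between the lists is harmless by the triangle inequality; all of `ys` then wait
  -- for the whole walk to `r`.
  waiting-++ : ∀ p xs r ys →
    waiting p (xs ++ ys) ≤ waiting p xs + ∣ ys ∣ₗ * pathLength p xs r + waiting r ys
  waiting-++ p []       r ys = ℚ.≤-trans (waiting-detour p r ys)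
    (ℚ.≤-reflexive (solve 2 (λ a w → a :+ w := con 0ℚ :+ a :+ w) refl (∣ ys ∣ₗ * d p r) (waiting r ys)))
  waiting-++ p (x ∷ xs) r ys = ≤-by _ (0≤q-p (waiting-++ x xs r ys))
    (trans (cong (λ w → w + ∣ ys ∣ₗ * (d p x + pathLength x xs r) + waiting r ys) (waiting-∷ p x xs))
    (trans (solve 7 (λ k k′ a w P w′ v → (con 1ℚ :+ k) :* a :+ w :+ k′ :* (a :+ P) :+ w′ :=
              ((con 1ℚ :+ (k :+ k′)) :* a :+ v) :+ (w :+ k′ :* P :+ w′ :- v))
            refl (∣ xs ∣ₗ) (∣ ys ∣ₗ) (d p x) (waiting x xs) (pathLength x xs r) (waiting r ys)
                (waiting x (xs ++ ys)))
    (cong (_+ (waiting x xs + ∣ ys ∣ₗ * pathLength x xs r + waiting r ys - waiting x (xs ++ ys)))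
      (trans (cong (λ k → (1ℚ + k) * d p x + waiting x (xs ++ ys))
               (sym (trans (cong ℕ→ℚ (List.length-++ xs)) (ℕ→ℚ-+ (length xs) (length ys)))))
             (sym (waiting-∷ p x (xs ++ ys)))))))

  waiting-∷ʳ : ∀ p xs y → waiting p (xs ++ y ∷ []) ≡ waiting p xs + pathLength p xs y
  waiting-∷ʳ p []       y = solve 1 (λ a → con 1ℚ :* a :+ con 0ℚ := con 0ℚ :+ a) refl (d p y)
  waiting-∷ʳ p (x ∷ xs) y = begin
    waiting p (x ∷ xs ++ y ∷ [])
      ≡⟨ waiting-∷ p x (xs ++ y ∷ []) ⟩
    (1ℚ + ∣ xs ++ y ∷ [] ∣ₗ) * d p x + waiting x (xs ++ y ∷ [])
      ≡⟨ cong₂ (λ k w → (1ℚ + k) * d p x + w)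
           (trans (cong ℕ→ℚ (List.length-++ xs)) (ℕ→ℚ-+ (length xs) 1)) (waiting-∷ʳ x xs y) ⟩
    (1ℚ + (∣ xs ∣ₗ + 1ℚ)) * d p x + (waiting x xs + pathLength x xs y)
      ≡⟨ solve 4 (λ k a w P → (con 1ℚ :+ (k :+ con 1ℚ)) :* a :+ (w :+ P) := (con 1ℚ :+ k) :* a :+ w
          :+ (a :+ P))
           refl (∣ xs ∣ₗ) (d p x) (waiting x xs) (pathLength x xs y) ⟩
    (1ℚ + ∣ xs ∣ₗ) * d p x + waiting x xs + (d p x + pathLength x xs y)
      ≡⟨ cong (_+ (d p x + pathLength x xs y)) (waiting-∷ p x xs) ⟨
    waiting p (x ∷ xs) + pathLength p (x ∷ xs) y ∎
    where open ≡-Reasoning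

  pathLength-∷ʳ : ∀ p xs y q → pathLength p (xs ++ y ∷ []) q ≡ pathLength p xs y + d y q
  pathLength-∷ʳ p []       y q = refl
  pathLength-∷ʳ p (x ∷ xs) y q = trans (cong (d p x +_) (pathLength-∷ʳ x xs y q))
                                   (sym (ℚ.+-assoc (d p x) (pathLength x xs y) (d y q)))

  pathLength-reverse : ∀ p xs q → pathLength q (reverse xs) p ≡ pathLength p xs q
  pathLength-reverse p []       q = d-sym q p
  pathLength-reverse p (x ∷ xs) q = begin
    pathLength q (reverse (x ∷ xs)) p        ≡⟨ cong (λ ys → pathLength q ys p)
        (List.unfold-reverse x xs) ⟩
    pathLength q (reverse xs ++ x ∷ []) p    ≡⟨ pathLength-∷ʳ q (reverse xs) x p ⟩
    pathLength q (reverse xs) x + d x p      ≡⟨ cong₂ _+_ (pathLength-reverse x xs q) (d-sym x p) ⟩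
    pathLength x xs q + d p x                ≡⟨ ℚ.+-comm (pathLength x xs q) (d p x) ⟩
    d p x + pathLength x xs q                ∎
    where open ≡-Reasoning

  -- The latencies of one node in the two directions add up to the length of the whole walk.
  waiting-reverse : ∀ p xs q → waiting p xs + waiting q (reverse xs) ≡ ∣ xs ∣ₗ * pathLength p xs q
  waiting-reverse p []       q = solve 1 (λ a → con 0ℚ :+ con 0ℚ := con 0ℚ :* a) refl (d p q)
  waiting-reverse p (x ∷ xs) q = begin
    waiting p (x ∷ xs) + waiting q (reverse (x ∷ xs))
      ≡⟨ cong₂ _+_ (waiting-∷ p x xs)
           (trans (cong (waiting q) (List.unfold-reverse x xs)) (waiting-∷ʳ q (reverse xs) x)) ⟩
    (1ℚ + ∣ xs ∣ₗ) * d p x + waiting x xs + (waiting q (reverse xs) + pathLength q (reverse xs) x)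
      ≡⟨ solve 5 (λ k a w w′ P → (con 1ℚ :+ k) :* a :+ w :+ (w′ :+ P) := (con 1ℚ :+ k) :* a
          :+ ((w :+ w′) :+ P))
           refl (∣ xs ∣ₗ) (d p x) (waiting x xs) (waiting q (reverse xs)) (pathLength q (reverse xs) x) ⟩
    (1ℚ + ∣ xs ∣ₗ) * d p x + ((waiting x xs + waiting q (reverse xs)) + pathLength q (reverse xs) x)
      ≡⟨ cong₂ (λ w P → (1ℚ + ∣ xs ∣ₗ) * d p x + (w + P)) (waiting-reverse x xs q)
          (pathLength-reverse x xs q) ⟩
    (1ℚ + ∣ xs ∣ₗ) * d p x + (∣ xs ∣ₗ * pathLength x xs q + pathLength x xs q)
      ≡⟨ solve 3 (λ k a P → (con 1ℚ :+ k) :* a :+ (k :* P :+ P) := (con 1ℚ :+ k) :* (a :+ P))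
           refl (∣ xs ∣ₗ) (d p x) (pathLength x xs q) ⟩
    (1ℚ + ∣ xs ∣ₗ) * pathLength p (x ∷ xs) q
      ≡⟨ cong (_* pathLength p (x ∷ xs) q) (ℕ→ℚ-suc (length xs)) ⟨
    ∣ x ∷ xs ∣ₗ * pathLength p (x ∷ xs) q ∎
    where open ≡-Reasoning

-- Inequalities for a single tour.

4ℚ 10ℚ 16ℚ : ℚ
4ℚ  = ℕ→ℚ 4
10ℚ = ℕ→ℚ 10
16ℚ = ℕ→ℚ 16

2*-cancel-≤ : ∀ {p q} → 2ℚ * p ≤ 2ℚ * q → p ≤ q
2*-cancel-≤ = ℚ.*-cancelˡ-≤-pos 2ℚ

-- With κ = u + w and ρ = c + b, the bound on the tour is the linearisation at
-- (c , w) of the concave function on the right-hand side of the conclusion.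
tour-exchange : ∀ u u′ w c b L → 0ℚ ≤ u′ → u′ ≤ u → 0ℚ ≤ w → 0ℚ ≤ c + b →
  (u + w) * L + (c + b) * u′ ≤ (u + w) * c + (c + b) * w →
  L * (u + u′) + b * u′ ≤ c * (u + w) + b * w
tour-exchange u u′ w c b L 0≤u′ u′≤u 0≤w 0≤ρ tour with ℚ.≤-total L c | ℚ.≤-total u′ w
... | inj₁ L≤c | inj₁ u′≤w = ≤-by _
  (0≤q-p L≤c 0≤* (ℚ.≤-trans 0≤u′ u′≤u 0≤+ 0≤u′) 0≤+ 0≤ρ 0≤* 0≤q-p u′≤w)
  (solve 6 (λ u u′ w c b L → c :* (u :+ w) :+ b :* w :=
      L :* (u :+ u′) :+ b :* u′ :+ ((c :- L) :* (u :+ u′) :+ (c :+ b) :* (w :- u′))) refl u u′ w c b L)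
-- The linearisation errs by exactly (L - c)(u′ - w), which is not positive here, since the factors
-- have opposite signs; so too in the next case.
... | inj₁ L≤c | inj₂ w≤u′ = ≤-by _ (0≤q-p tour 0≤+ 0≤q-p L≤c 0≤* 0≤q-p w≤u′)
  (solve 6 (λ u u′ w c b L → c :* (u :+ w) :+ b :* w :=
      L :* (u :+ u′) :+ b :* u′ :+
        (((u :+ w) :* c :+ (c :+ b) :* w :- ((u :+ w) :* L :+ (c :+ b) :* u′)) :+ (c :- L)
            :* (u′ :- w))) refl u u′ w c b L)
... | inj₂ c≤L | inj₁ u′≤w = ≤-by _ (0≤q-p tour 0≤+ 0≤q-p c≤L 0≤* 0≤q-p u′≤w)
  (solve 6 (λ u u′ w c b L → c :* (u :+ w) :+ b :* w :=
      L :* (u :+ u′) :+ b :* u′ :+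
        (((u :+ w) :* c :+ (c :+ b) :* w :- ((u :+ w) :* L :+ (c :+ b) :* u′)) :+ (L :- c)
            :* (w :- u′))) refl u u′ w c b L)
-- Now the error is not negative. As u′ - w ≤ u + w, it is at most (u + w)(L - c), which `tour`
-- forces to be at most 0.
... | inj₂ c≤L | inj₂ w≤u′ = ≤-by _
  (0≤q-p tour 0≤+ (0≤q-p tour 0≤+ 0≤ρ 0≤* 0≤q-p w≤u′ 0≤+ 0≤q-p c≤L 0≤* (0≤q-p u′≤u 0≤+ (0≤w 0≤+ 0≤w))))
  (solve 6 (λ u u′ w c b L → c :* (u :+ w) :+ b :* w :=
      L :* (u :+ u′) :+ b :* u′ :+
        (((u :+ w) :* c :+ (c :+ b) :* w :- ((u :+ w) :* L :+ (c :+ b) :* u′)) :+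
         (((u :+ w) :* c :+ (c :+ b) :* w :- ((u :+ w) :* L :+ (c :+ b) :* u′)) :+ (c :+ b) :* (u′ :- w)
          :+ (L :- c) :* (u :- u′ :+ (w :+ w))))) refl u u′ w c b L)

last-tour : ∀ u L t V ρ → u * L + ρ * 0ℚ ≤ u * (4ℚ * t) + ρ * 0ℚ →
            2ℚ * V ≤ L * (u + 0ℚ) + 2ℚ * 0ℚ → V ≤ 2ℚ * (t * u) + 0ℚ
last-tour u L t V ρ tour V≤ = 2*-cancel-≤ (≤-by _ (0≤q-p tour 0≤+ 0≤q-p V≤)
  (solve 5 (λ u L t V ρ → con 2ℚ :* (con 2ℚ :* (t :* u) :+ con 0ℚ) :=
      con 2ℚ :* V :+ ((u :* (con 4ℚ :* t) :+ ρ :* con 0ℚ :- (u :* L :+ ρ :* con 0ℚ)) :+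
                      (L :* (u :+ con 0ℚ) :+ con 2ℚ :* con 0ℚ :- con 2ℚ :* V)))
    refl u L t V ρ))

-- The penalty for one missed node exceeds the whole budget `B`, and `m` is an integer.
nothing-left : ∀ m A B → 0ℚ ≤ A → 0ℚ ≤ B → A + (B + 1ℚ) * ℕ→ℚ m ≤ B + (B + 1ℚ) * 0ℚ → m ≡ 0
nothing-left zero    A B _   _   _    = refl
nothing-left (suc m) A B 0≤A 0≤B tour = contradiction 1≤0 λ where (*≤* (ℤ.+≤+ ()))
  where
  1≤0 : 1ℚ ≤ 0ℚ
  1≤0 = ≤-by _ (0≤q-p tour 0≤+ (0≤A 0≤+ (0≤B 0≤+ 0≤1) 0≤* ℕ→ℚ-nonNeg m))
    (trans
      (solve 3 (λ A B m → con 0ℚ := con 1ℚ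
          :+ ((B :+ (B :+ con 1ℚ) :* con 0ℚ :- (A :+ (B :+ con 1ℚ) :* (con 1ℚ :+ m)))
        :+ (A :+ (B :+ con 1ℚ) :* m))) refl A B (ℕ→ℚ m))
      (cong (λ k → 1ℚ + ((B + (B + 1ℚ) * 0ℚ - (A + (B + 1ℚ) * k)) + (A + (B + 1ℚ) * ℕ→ℚ m)))
          (sym (ℕ→ℚ-suc m))))

-- The 16 is twice the 2 · 4 that the later tours charge per node of `u′`. In total this is half of
-- 4t (u + w) + 16t w, that is, 2t u + 10t w.
inner-tour : ∀ u u′ w t L V Z B →
  L * (u + u′) + 16ℚ * t * u′ ≤ 4ℚ * t * (u + w) + 16ℚ * t * w →
  2ℚ * V ≤ L * (u + u′) + 2ℚ * Z → Z ≤ 2ℚ * (4ℚ * t * u′) + B →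
  V ≤ 2ℚ * (t * u) + (10ℚ * (t * w) + B)
inner-tour u u′ w t L V Z B tour V≤ Z≤ =
    2*-cancel-≤ (≤-by _ (0≤q-p tour 0≤+ 0≤q-p V≤ 0≤+ 0≤2 0≤* 0≤q-p Z≤)
  (solve 8 (λ u u′ w t L V Z B → con 2ℚ :* (con 2ℚ :* (t :* u) :+ (con 10ℚ :* (t :* w) :+ B)) :=
      con 2ℚ :* V :+
      (((con 4ℚ :* t :* (u :+ w) :+ con 16ℚ :* t :* w) :- (L :* (u :+ u′) :+ con 16ℚ :* t :* u′))
       :+ (L :* (u :+ u′) :+ con 2ℚ :* Z :- con 2ℚ :* V)
       :+ con 2ℚ :* (con 2ℚ :* (con 4ℚ :* t :* u′) :+ B :- Z)))
    refl u u′ w t L V Z B))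

-- The `k` nodes of the tour wait at most P/2 on average and the `k′` later ones wait P each, which
-- is P (u + u′) / 2 in all.
tour-then-rest : ∀ k k′ L P V X Z {u u′} → k + k′ ≡ u → k′ ≡ u′ → 0ℚ ≤ k → 0ℚ ≤ k′ → P ≤ L →
  2ℚ * V ≤ k * P → X ≤ V + k′ * P + Z → 2ℚ * X ≤ L * (u + u′) + 2ℚ * Z
tour-then-rest k k′ L P V X Z refl refl 0≤k 0≤k′ P≤L V≤ X≤ = ≤-by _
  (0≤2 0≤* 0≤q-p X≤ 0≤+ 0≤q-p V≤ 0≤+ 0≤q-p P≤L 0≤* ((0≤k 0≤+ 0≤k′) 0≤+ 0≤k′))
  (solve 7 (λ L P k k′ V Z X → L :* (k :+ k′ :+ k′) :+ con 2ℚ :* Z :=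
      con 2ℚ :* X :+ (con 2ℚ :* ((V :+ k′ :* P :+ Z) :- X) :+ (k :* P :- con 2ℚ :* V)
        :+ (L :- P) :* (k :+ k′ :+ k′)))
    refl L P k k′ V Z X)

missed-tour : ∀ A B ρ m n k → 0ℚ ≤ ρ → m + k ≤ n → A + ρ * n ≤ B + ρ * k → A + ρ * m ≤ B
missed-tour A B ρ m n k 0≤ρ m+k≤n bound = ≤-by _ (0≤q-p bound 0≤+ 0≤ρ 0≤* 0≤q-p m+k≤n)
  (solve 6 (λ A B ρ m n k → B := A :+ ρ :* m :+ ((B :+ ρ :* k :- (A :+ ρ :* n)) :+ ρ :* (n :- (m :+ k))))
    refl A B ρ m n k)

-- Concatenating tours for geometrically growing times.

last : ℕ → ℕ → ℕ
last zero    τ = τ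
last (suc k) τ = last k (4 ℕ.* τ)

-- The last time has no term, because `W` vanishes there.
tail-bound : (ℕ → ℚ) → ℕ → ℕ → ℚ
tail-bound W zero    τ = 0ℚ
tail-bound W (suc k) τ = 10ℚ * (ℕ→ℚ τ * W τ) + tail-bound W k (4 ℕ.* τ)

module Concatenation {n : ℕ} (d : Node n → Node n → ℚ) (0≤d : ∀ x y → 0ℚ ≤ d x y)
  (d-sym : ∀ x y → d x y ≡ d y x) (triangle : ∀ x y z → d x z ≤ d x y + d y z) where
  open Travel d 0≤d d-sym triangle

  -- Skipping nodes outside `R` shortens the tour, and the better direction has at most half of the
  -- waiting of both together.
  better-direction : ∀ (R : Node n → Bool) xs → ∃[ ys ]
    (∀ x → count x ys ≡ count x (filterᵇ R xs)) ×
    2ℚ * waiting zero ys ≤ ∣ ys ∣ₗ * pathLength zero ys zero ×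
    pathLength zero ys zero ≤ pathLength zero xs zero
  better-direction R xs = choose (ℚ.≤-total (waiting zero ys) (waiting zero (reverse ys)))
    where
    ys : List (Node n)
    ys = filterᵇ R xs
    choose : waiting zero ys ≤ waiting zero (reverse ys) ⊎ waiting zero (reverse ys)
        ≤ waiting zero ys → _
    choose (inj₁ fwd) = ys , (λ _ → refl) , ≤-by _ (0≤q-p fwd)
      (trans (sym (waiting-reverse zero ys zero))
        (solve 2 (λ a b → a :+ b := con 2ℚ :* a :+ (b :- a)) refl
            (waiting zero ys) (waiting zero (reverse ys)))) ,
      pathLength-filter R zero xs zero
    choose (inj₂ bwd) = reverse ys , (λ x → count-reverse x ys) , ≤-by _ (0≤q-p bwd)
      (trans (cong₂ (λ k L → ℕ→ℚ k * L) (List.length-reverse ys) (pathLength-reverse zero ys zero))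
        (trans (sym (waiting-reverse zero ys zero))
          (solve 2 (λ a b → a :+ b := con 2ℚ :* b :+ (a :- b)) refl
              (waiting zero ys) (waiting zero (reverse ys))))) ,
      subst (_≤ pathLength zero xs zero) (sym (pathLength-reverse zero ys zero))
          (pathLength-filter R zero xs zero)

  prepend-tour : ∀ (R : Node n → Bool) xs zs → (∀ x → count x xs ℕ.≤ 1) → Enumerates (R ∖ xs) zs →
      ∃[ ws ]
    Enumerates R ws ×
    2ℚ * waiting zero ws ≤ pathLength zero xs zero * (ℕ→ℚ (# R) + ℕ→ℚ (# (R ∖ xs)))
        + 2ℚ * waiting zero zs
  prepend-tour R xs zs once enum = prepend (better-direction R xs)
    where
    prepend : _ → _
    prepend (ys , ys≡ , direction , shorter) = ys ++ zs , enum′ ,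
      tour-then-rest (∣ ys ∣ₗ) (∣ zs ∣ₗ) (pathLength zero xs zero) (pathLength zero ys zero)
        (waiting zero ys) (waiting zero (ys ++ zs)) (waiting zero zs) sizes
            (cong ℕ→ℚ (length-enumerates (R ∖ xs) zs enum))
        (ℕ→ℚ-nonNeg (length ys)) (ℕ→ℚ-nonNeg (length zs)) shorter direction (waiting-++ zero ys zero zs)
      where
      enum′ : Enumerates R (ys ++ zs)
      enum′ = ∖-enumerates R xs ys zs once ys≡ enum
      sizes : ∣ ys ∣ₗ + ∣ zs ∣ₗ ≡ ℕ→ℚ (# R)
      sizes = trans (sym (ℕ→ℚ-+ (length ys) (length zs)))
        (cong ℕ→ℚ (trans (sym (List.length-++ ys)) (length-enumerates R (ys ++ zs) enum′)))

  -- W τ plays the role of the number of nodes that a fractional tour of length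
  -- 4 τ leaves unvisited.
  module _ (W : ℕ → ℚ) (0≤W : ∀ τ → 0ℚ ≤ W τ)
    (tour : ∀ τ → 1 ℕ.≤ τ → ∀ κ ρ → 0ℚ ≤ κ → 0ℚ ≤ ρ → ∃[ xs ]
      (∀ x → count x xs ℕ.≤ 1) × count zero xs ≡ 0 ×
      κ * pathLength zero xs zero + ρ * ℕ→ℚ n ≤ κ * (4ℚ * ℕ→ℚ τ) + ρ * W τ + ρ * ∣ xs ∣ₗ) where

    tour-within : ∀ R → R zero ≡ false → ∀ τ → 1 ℕ.≤ τ → ∀ κ ρ → 0ℚ ≤ κ → 0ℚ ≤ ρ → ∃[ xs ]
      (∀ x → count x xs ℕ.≤ 1) ×
      κ * pathLength zero xs zero + ρ * ℕ→ℚ (# (R ∖ xs)) ≤ κ * (4ℚ * ℕ→ℚ τ) + ρ * W τ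
    tour-within R R0 τ 1≤τ κ ρ 0≤κ 0≤ρ = within (tour τ 1≤τ κ ρ 0≤κ 0≤ρ)
      where
      within : _ → _
      within (xs , once , no-root , bound) = xs , once , missed-tour (κ * pathLength zero xs zero)
        (κ * (4ℚ * ℕ→ℚ τ) + ρ * W τ) ρ (ℕ→ℚ (# (R ∖ xs))) (ℕ→ℚ n) (∣ xs ∣ₗ) 0≤ρ missed bound
        where
        missed : ℕ→ℚ (# (R ∖ xs)) + ∣ xs ∣ₗ ≤ ℕ→ℚ n
        missed = subst (_≤ ℕ→ℚ n) (ℕ→ℚ-+ (# (R ∖ xs)) (length xs))
            (ℕ→ℚ-mono-≤ (∖-# R xs R0 once no-root))

    ∖-≤ : ∀ (R : Node n → Bool) xs → # (R ∖ xs) ℕ.≤ # R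
    ∖-≤ R xs = ∑ℕ-mono λ x → cases (R x) (count x xs ℕ.≡ᵇ 0)
      where
      cases : ∀ b b′ → (if b ∧ b′ then 1 else 0) ℕ.≤ (if b then 1 else 0)
      cases false _     = z≤n
      cases true  false = z≤n
      cases true  true  = ℕ.≤-refl

    last-step : ∀ τ R xs → (∀ x → count x xs ℕ.≤ 1) →
      let u = ℕ→ℚ (# R); c = 4ℚ * ℕ→ℚ τ in
      u * pathLength zero xs zero + (u * c + 1ℚ) * ℕ→ℚ (# (R ∖ xs)) ≤ u * c + (u * c + 1ℚ) * 0ℚ →
      ∃[ ws ] Enumerates R ws × waiting zero ws ≤ 2ℚ * (ℕ→ℚ τ * u) + 0ℚ
    last-step τ R xs once bound =
      map₂ (λ {ws} → map₂ λ ws≤ → last-tour u L (ℕ→ℚ τ) (waiting zero ws) (u * c + 1ℚ)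
             (subst (λ m → u * L + (u * c + 1ℚ) * ℕ→ℚ m ≤ u * c + (u * c + 1ℚ) * 0ℚ) none bound)
             (subst (λ m → 2ℚ * waiting zero ws ≤ L * (u + ℕ→ℚ m) + 2ℚ * 0ℚ) none ws≤))
           (prepend-tour R xs [] once (λ x → sym (∑ℕ≡0 (λ x → if (R ∖ xs) x then 1 else 0) none x)))
      where
      u c L : ℚ
      u = ℕ→ℚ (# R)
      c = 4ℚ * ℕ→ℚ τ
      L = pathLength zero xs zero
      none : # (R ∖ xs) ≡ 0
      none = nothing-left (# (R ∖ xs)) (u * L) (u * c) (ℕ→ℚ-nonNeg (# R) 0≤* 0≤pathLength zero xs zero)
               (ℕ→ℚ-nonNeg (# R) 0≤* (ℕ→ℚ-nonNeg 4 0≤* ℕ→ℚ-nonNeg τ)) bound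

    inner-step : ∀ τ B R xs zs → (∀ x → count x xs ℕ.≤ 1) →
      let t = ℕ→ℚ τ; u = ℕ→ℚ (# R); u′ = ℕ→ℚ (# (R ∖ xs)) in
      (u + W τ) * pathLength zero xs zero + (4ℚ * t + 16ℚ * t) * u′ ≤
        (u + W τ) * (4ℚ * t) + (4ℚ * t + 16ℚ * t) * W τ →
      Enumerates (R ∖ xs) zs → waiting zero zs ≤ 2ℚ * (4ℚ * t * u′) + B →
      ∃[ ws ] Enumerates R ws × waiting zero ws ≤ 2ℚ * (t * u) + (10ℚ * (t * W τ) + B)
    inner-step τ B R xs zs once bound enum zs≤ =
      map₂ (λ {ws} → map₂ λ ws≤ → inner-tour u u′ (W τ) t L (waiting zero ws) (waiting zero zs) B
             (tour-exchange u u′ (W τ) (4ℚ * t) (16ℚ * t) L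
             (ℕ→ℚ-nonNeg (# (R ∖ xs))) (ℕ→ℚ-mono-≤ (∖-≤ R xs)) (0≤W τ)
             (ℕ→ℚ-nonNeg 4 0≤* ℕ→ℚ-nonNeg τ 0≤+ ℕ→ℚ-nonNeg 16 0≤* ℕ→ℚ-nonNeg τ) bound) ws≤ zs≤)
           (prepend-tour R xs zs once enum)
      where
      t u u′ L : ℚ
      t  = ℕ→ℚ τ
      u  = ℕ→ℚ (# R)
      u′ = ℕ→ℚ (# (R ∖ xs))
      L  = pathLength zero xs zero

    concatenate : ∀ k τ → 1 ℕ.≤ τ → W (last k τ) ≡ 0ℚ → ∀ R → R zero ≡ false → ∃[ ws ]
      Enumerates R ws × waiting zero ws ≤ 2ℚ * (ℕ→ℚ τ * ℕ→ℚ (# R)) + tail-bound W k τ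
    concatenate zero τ 1≤τ W≡0 R R0 = finish
      -- A rate so high that, with `W` equal to 0 at this time, the tour can miss nothing.
      (tour-within R R0 τ 1≤τ u (u * c + 1ℚ) (ℕ→ℚ-nonNeg (# R))
        (ℕ→ℚ-nonNeg (# R) 0≤* (ℕ→ℚ-nonNeg 4 0≤* ℕ→ℚ-nonNeg τ) 0≤+ 0≤1))
      where
      u c : ℚ
      u = ℕ→ℚ (# R)
      c = 4ℚ * ℕ→ℚ τ
      finish : _ → _
      finish (xs , once , bound) = last-step τ R xs once
        (subst (λ w → u * pathLength zero xs zero + (u * c + 1ℚ) * ℕ→ℚ (# (R ∖ xs)) ≤ u * c
            + (u * c + 1ℚ) * w) W≡0 bound)
    concatenate (suc k) τ 1≤τ W≡0 R R0 = continue
      -- The rates are the partial derivatives of L (u + u′) + 16τ u′ at L = 4τ and u′ = W τ, as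
      -- `tour-exchange` requires.
      (tour-within R R0 τ 1≤τ (ℕ→ℚ (# R) + W τ) (4ℚ * ℕ→ℚ τ + 16ℚ * ℕ→ℚ τ) (ℕ→ℚ-nonNeg (# R) 0≤+ 0≤W τ)
        (ℕ→ℚ-nonNeg 4 0≤* ℕ→ℚ-nonNeg τ 0≤+ ℕ→ℚ-nonNeg 16 0≤* ℕ→ℚ-nonNeg τ))
      where
      continue : _ → _
      continue (xs , once , bound) = prepend
        (concatenate k (4 ℕ.* τ) (ℕ.≤-trans 1≤τ (ℕ.m≤n*m τ 4)) W≡0 (R ∖ xs)
            (cong (_∧ (count zero xs ℕ.≡ᵇ 0)) R0))
        where
        prepend : _ → _
        prepend (zs , enum , zs≤) = inner-step τ (tail-bound W k (4 ℕ.* τ)) R xs zs once bound enum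
          (subst (λ t → waiting zero zs ≤ 2ℚ * (t * ℕ→ℚ (# (R ∖ xs))) + tail-bound W k (4 ℕ.* τ))
              (ℕ→ℚ-* 4 τ) zs≤)

-- From enumerations to permutations.

count-lookup : ∀ {n} (xs : List (Fin n)) i → 1 ℕ.≤ count (lookup xs i) xs
count-lookup (x ∷ xs) zero    rewrite ≡ᵇ-refl x = s≤s z≤n
count-lookup (x ∷ xs) (suc i) = ℕ.≤-trans (count-lookup xs i) (ℕ.m≤n+m (count (lookup xs i) xs) _)

find : ∀ {n} (x : Fin n) xs → 1 ℕ.≤ count x xs → ∃[ i ] lookup xs i ≡ x
find x (y ∷ xs) 1≤ with x Fin.≟ y
... | yes refl = zero , refl
... | no _     = let i , eq = find x xs 1≤ in suc i , eq

lookup-injective : ∀ {n} (xs : List (Fin n)) → (∀ x → count x xs ℕ.≤ 1) →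
                   ∀ i j → lookup xs i ≡ lookup xs j → i ≡ j
lookup-injective (x ∷ xs) once zero    zero    _ = refl
lookup-injective (x ∷ xs) once (suc i) (suc j) eq =
  cong suc (lookup-injective xs (λ y → ℕ.≤-trans (ℕ.m≤n+m (count y xs) _) (once y)) i j eq)
lookup-injective (x ∷ xs) once zero    (suc j) refl = contradiction (once (lookup xs j))
    (twice (count-lookup xs j))
  where
  twice : 1 ℕ.≤ count (lookup xs j) xs → ¬ count (lookup xs j) (lookup xs j ∷ xs) ℕ.≤ 1
  twice 1≤ rewrite ≡ᵇ-refl (lookup xs j) = λ where (s≤s ≤0) → ℕ.n≮0 (ℕ.≤-trans 1≤ ≤0)
lookup-injective (x ∷ xs) once (suc i) zero refl = contradiction (once (lookup xs i))
    (twice (count-lookup xs i))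
  where
  twice : 1 ℕ.≤ count (lookup xs i) xs → ¬ count (lookup xs i) (lookup xs i ∷ xs) ℕ.≤ 1
  twice 1≤ rewrite ≡ᵇ-refl (lookup xs i) = λ where (s≤s ≤0) → ℕ.n≮0 (ℕ.≤-trans 1≤ ≤0)

nonRoot : ∀ {n} → Node n → Bool
nonRoot zero    = false
nonRoot (suc _) = true

#-nonRoot : ∀ n → # (nonRoot {n}) ≡ n
#-nonRoot n = ∑ℕ-const-1 n

module _ {n : ℕ} (xs : List (Node n)) (enum : Enumerates nonRoot xs) where

  private
    len : length xs ≡ n
    len = trans (length-enumerates nonRoot xs enum) (#-nonRoot n)

    once : ∀ x → count x xs ℕ.≤ 1
    once zero    = ℕ.≤-trans (ℕ.≤-reflexive (enum zero)) z≤n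
    once (suc j) = ℕ.≤-reflexive (enum (suc j))

    at : Fin n → Node n
    at i = lookup xs (cast (sym len) i)

    root≢at : ∀ i → zero ≢ at i
    root≢at i eq = ℕ.n≮0 (subst (1 ℕ.≤_) (trans (cong (λ x → count x xs) (sym eq)) (enum zero))
                             (count-lookup xs (cast (sym len) i)))

    to : Fin n → Fin n
    to i = punchOut (root≢at i)

    suc-to : ∀ i → suc (to i) ≡ at i
    suc-to i = Fin.punchIn-punchOut (root≢at i)

    position : ∀ j → ∃[ i ] lookup xs i ≡ suc j
    position j = find (suc j) xs (ℕ.≤-reflexive (sym (enum (suc j))))

    from : Fin n → Fin n
    from j = cast len (proj₁ (position j))

    at-from : ∀ j → at (from j) ≡ suc j
    at-from j = trans (cong (lookup xs) (Fin.cast-involutive (sym len) len (proj₁ (position j))))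
        (proj₂ (position j))

    at-injective : ∀ i j → at i ≡ at j → i ≡ j
    at-injective i j eq = begin
      i                             ≡⟨ Fin.cast-involutive len (sym len) i ⟨
      cast len (cast (sym len) i)   ≡⟨ cong (cast len) (lookup-injective xs once _ _ eq) ⟩
      cast len (cast (sym len) j)   ≡⟨ Fin.cast-involutive len (sym len) j ⟩
      j                             ∎
      where open ≡-Reasoning

  listPath : Path n
  listPath = Permutation.permutation to from
    (λ j → Fin.suc-injective (trans (suc-to (from j)) (at-from j)))
    (λ i → at-injective (from (to i)) i (trans (at-from (to i)) (suc-to i)))

  listPath-length : length xs ≡ n
  listPath-length = len

  visit-listPath : ∀ i → visit listPath (suc i) ≡ lookup xs (cast (sym listPath-length) i)
  visit-listPath = suc-to

-- Total latency in visiting order.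

accumulated : ∀ {A : Set} (D : A → A → ℕ) {m} → (Fin (suc m) → A) → ℕ
accumulated D {m} f = ∑ℕ {m} λ k → ∑ℕ λ i → if does (i Fin.≤? k) then D (f (inject₁ i))
    (f (suc i)) else 0

-- The first leg belongs to the latency of all `suc m` nodes. Arbitrary sequences of points, rather
-- than paths from the root, make this recursion possible.
accumulated-suc : ∀ {A : Set} (D : A → A → ℕ) {m} (f : Fin (suc (suc m)) → A) →
  accumulated D f ≡ suc m ℕ.* D (f zero) (f (suc zero)) ℕ.+ accumulated D (f ∘ suc)
accumulated-suc D {m} f = begin
  (D₀ ℕ.+ ∑ℕ {m} (λ _ → 0)) ℕ.+ ∑ℕ (λ k → D₀ ℕ.+ inner k)
    ≡⟨ cong₂ ℕ._+_ (trans (cong (D₀ ℕ.+_) (∑ℕ-zero m)) (ℕ.+-identityʳ D₀))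
         (trans (∑ℕ-+ (λ _ → D₀) inner) (cong₂ ℕ._+_ (∑ℕ-const m D₀) (∑ℕ-cong {m} λ k → ∑ℕ-cong {m} λ i →
           cong (λ b → if b then D (f (inject₁ (suc i))) (f (suc (suc i))) else 0)
               (suc-≤? (toℕ i) (toℕ k))))) ⟩
  D₀ ℕ.+ (m ℕ.* D₀ ℕ.+ accumulated D (f ∘ suc))
    ≡⟨ ℕ.+-assoc D₀ (m ℕ.* D₀) _ ⟨
  suc m ℕ.* D₀ ℕ.+ accumulated D (f ∘ suc) ∎
  where
  open ≡-Reasoning
  D₀ = D (f zero) (f (suc zero))
  inner : Fin m → ℕ
  inner k = ∑ℕ λ i → if does (suc i Fin.≤? suc k) then D (f (inject₁ (suc i))) (f (suc (suc i))) else 0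
  suc-≤? : ∀ a b → does (suc a ℕ.≤? suc b) ≡ does (a ℕ.≤? b)
  suc-≤? zero    b = refl
  suc-≤? (suc a) b = refl
  ∑ℕ-const : ∀ m a → ∑ℕ {m} (λ _ → a) ≡ m ℕ.* a
  ∑ℕ-const zero    a = refl
  ∑ℕ-const (suc m) a = cong (a ℕ.+_) (∑ℕ-const m a)

module _ {n : ℕ} (I : Instance n) where
  open Instance I

  totalLatency-accumulated : ∀ P → totalLatency I P ≡ accumulated d (visit P)
  totalLatency-accumulated P = sym (Sum.sum-permute ℕ.+-0-commutativeMonoid
    (λ k → ∑ℕ λ i → if does (i Fin.≤? k) then d (visit P (inject₁ i)) (visit P (suc i)) else 0)
    (Permutation.flip P))

  module _ (0≤d : ∀ x y → 0ℚ ≤ ℕ→ℚ (d x y)) (d-sym : ∀ x y → ℕ→ℚ (d x y) ≡ ℕ→ℚ (d y x))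
           (triangle : ∀ x y z → ℕ→ℚ (d x z) ≤ ℕ→ℚ (d x y) + ℕ→ℚ (d y z)) where
    open Travel (λ x y → ℕ→ℚ (d x y)) 0≤d d-sym triangle

    waiting-accumulated : ∀ p xs {m} (len : length xs ≡ m) (f : Fin (suc m) → Node n) → f zero ≡ p →
      (∀ i → f (suc i) ≡ lookup xs (cast (sym len) i)) → ℕ→ℚ (accumulated d f) ≡ waiting p xs
    waiting-accumulated p []       refl f f0 fsuc = refl
    waiting-accumulated p (x ∷ xs) refl f refl fsuc = begin
      ℕ→ℚ (accumulated d f)
        ≡⟨ cong ℕ→ℚ (accumulated-suc d f) ⟩
      ℕ→ℚ (suc (length xs) ℕ.* d (f zero) (f (suc zero)) ℕ.+ accumulated d (f ∘ suc))
        ≡⟨ ℕ→ℚ-+ (suc (length xs) ℕ.* d (f zero) (f (suc zero))) (accumulated d (f ∘ suc)) ⟩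
      ℕ→ℚ (suc (length xs) ℕ.* d (f zero) (f (suc zero))) + ℕ→ℚ (accumulated d (f ∘ suc))
        ≡⟨ cong₂ _+_
             (trans (ℕ→ℚ-* (suc (length xs)) (d (f zero) (f (suc zero))))
               (cong (λ y → ∣ x ∷ xs ∣ₗ * ℕ→ℚ (d (f zero) y)) (fsuc zero)))
             (waiting-accumulated x xs refl (f ∘ suc) (fsuc zero) (fsuc ∘ suc)) ⟩
      waiting (f zero) (x ∷ xs) ∎
      where open ≡-Reasoning

    totalLatency-listPath : ∀ xs (enum : Enumerates nonRoot xs) →
      ℕ→ℚ (totalLatency I (listPath xs enum)) ≡ waiting zero xs
    totalLatency-listPath xs enum = trans (cong ℕ→ℚ (totalLatency-accumulated (listPath xs enum)))
      (waiting-accumulated zero xs (listPath-length xs enum) (visit (listPath xs enum)) refl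
          (visit-listPath xs enum))

-- Flattening edge sums and doubling trees.

∑-splitAt : ∀ a {b} (f : Fin a → ℚ) (g : Fin b → ℚ) → ∑ℚ ([ f , g ]′ ∘ splitAt a) ≡ ∑ℚ f + ∑ℚ g
∑-splitAt zero    f g = sym (ℚ.+-identityˡ (∑ℚ g))
∑-splitAt (suc a) {b} f g = trans
  (cong (f zero +_) (trans (∑-cong {a ℕ.+ b} (λ i → shift (splitAt a i))) (∑-splitAt a (f ∘ suc) g)))
  (sym (ℚ.+-assoc (f zero) (∑ℚ (f ∘ suc)) (∑ℚ g)))
  where
  shift : ∀ s → [ f , g ]′ (map₁ suc s) ≡ [ f ∘ suc , g ]′ s
  shift (inj₁ _) = refl
  shift (inj₂ _) = refl

-- Supplies the edge indices `Fin M` of the prize-collecting problem. Equality of sums is all that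
-- has to be known about the enumeration.
∑-Σ : ∀ {k} (m : Fin k → ℕ) → ∃[ M ] Σ (Fin M → Σ (Fin k) (Fin ∘ m)) λ pair →
      ∀ f → ∑ℚ (λ v → ∑ℚ (λ u → f (v , u))) ≡ ∑ℚ (f ∘ pair)
∑-Σ {zero}  m = 0 , (λ ()) , λ _ → refl
∑-Σ {suc k} m = extend (∑-Σ (m ∘ suc))
  where
  next : Σ (Fin k) (Fin ∘ m ∘ suc) → Σ (Fin (suc k)) (Fin ∘ m)
  next (v , u) = suc v , u
  extend : _ → _
  extend (M , pair , ∑≡) = m zero ℕ.+ M , [ (zero ,_) , next ∘ pair ]′ ∘ splitAt (m zero) , λ f → begin
    ∑ℚ (λ u → f (zero , u)) + ∑ℚ (λ v → ∑ℚ (λ u → f (suc v , u)))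
      ≡⟨ cong (∑ℚ (λ u → f (zero , u)) +_) (∑≡ (f ∘ next)) ⟩
    ∑ℚ (λ u → f (zero , u)) + ∑ℚ (f ∘ next ∘ pair)
      ≡⟨ ∑-splitAt (m zero) (λ u → f (zero , u)) (f ∘ next ∘ pair) ⟨
    ∑ℚ ([ (λ u → f (zero , u)) , f ∘ next ∘ pair ]′ ∘ splitAt (m zero))
      ≡⟨ ∑-cong (λ i → push f (splitAt (m zero) i)) ⟩
    ∑ℚ (f ∘ [ (zero ,_) , next ∘ pair ]′ ∘ splitAt (m zero)) ∎
    where
    open ≡-Reasoning
    push : ∀ f s → [ (λ u → f (zero , u)) , f ∘ next ∘ pair ]′ s ≡ f ([ (zero ,_) , next ∘ pair ]′ s)
    push f (inj₁ _) = refl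
    push f (inj₂ _) = refl

∑-const : ∀ n p → ∑ℚ {n} (λ _ → p) ≡ p * ℕ→ℚ n
∑-const zero    p = sym (ℚ.*-zeroʳ p)
∑-const (suc n) p = trans (cong (p +_) (∑-const n p))
  (trans (solve 2 (λ p k → p :+ p :* k := p :* (con 1ℚ :+ k)) refl p (ℕ→ℚ n))
      (cong (p *_) (sym (ℕ→ℚ-suc n))))

cost-* : ∀ {V E} p (c : E → ℚ) (t : Forest V E) → cost (λ e → p * c e) t ≡ p * cost c t
cost-* p c []               = sym (ℚ.*-zeroʳ p)
cost-* p c (node v e ks ss) = trans (cong₂ (λ a b → p * c e + (a + b)) (cost-* p c ks) (cost-* p c ss))
  (solve 4 (λ p c a b → p :* c :+ (p :* a :+ p :* b) := p :* (c :+ (a :+ b))) refl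
      p (c e) (cost c ks) (cost c ss))

fromRest : ∀ {n} → (Fin n → ℚ) → Node n → ℚ
fromRest f zero    = 0ℚ
fromRest f (suc j) = f j

weight-const : ∀ {n E} {h l : E → Node n} p ρ t → HangsOn h l p t →
               weight (fromRest (λ _ → ρ)) t ≡ ρ * ∣ preorder t ∣ₗ
weight-const p ρ [] _ = sym (ℚ.*-zeroʳ ρ)
weight-const p ρ (node zero    e ks ss) (v≢0 , _) = contradiction refl v≢0
weight-const p ρ (node (suc v) e ks ss) (_ , _ , hk , hs) = begin
  ρ + (weight (fromRest (λ _ → ρ)) ks + weight (fromRest (λ _ → ρ)) ss)
    ≡⟨ cong₂ (λ a b → ρ + (a + b)) (weight-const (suc v) ρ ks hk) (weight-const p ρ ss hs) ⟩
  ρ + (ρ * ∣ preorder ks ∣ₗ + ρ * ∣ preorder ss ∣ₗ)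
    ≡⟨ solve 3 (λ ρ a b → ρ :+ (ρ :* a :+ ρ :* b) := ρ :* (con 1ℚ :+ (a :+ b))) refl
        ρ (∣ preorder ks ∣ₗ) (∣ preorder ss ∣ₗ) ⟩
  ρ * (1ℚ + (∣ preorder ks ∣ₗ + ∣ preorder ss ∣ₗ))
    ≡⟨ cong (λ k → ρ * (1ℚ + k)) (trans (cong ℕ→ℚ (List.length-++ (preorder ks)))
        (ℕ→ℚ-+ (length (preorder ks)) _)) ⟨
  ρ * (1ℚ + ∣ preorder ks ++ preorder ss ∣ₗ)
    ≡⟨ cong (ρ *_) (ℕ→ℚ-suc (length (preorder ks ++ preorder ss))) ⟨
  ρ * ∣ suc v ∷ preorder ks ++ preorder ss ∣ₗ ∎
  where open ≡-Reasoning

-- Costs carry the factor 4κ: one 2 pays for doubling the tree, the other matches the 2 on the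
-- penalties and is divided out.
doubled-tree : ∀ κ ρ C L N Q w k τ → 0ℚ ≤ κ → L ≤ 2ℚ * C + 0ℚ → Q ≤ 4ℚ * κ * τ →
  4ℚ * κ * C + 2ℚ * (0ℚ + ρ * N) ≤ 2ℚ * (Q + (0ℚ * 0ℚ + ρ * w)) + 2ℚ * (0ℚ + ρ * k) →
  κ * L + ρ * N ≤ κ * (4ℚ * τ) + ρ * w + ρ * k
doubled-tree κ ρ C L N Q w k τ 0≤κ L≤ Q≤ bound = 2*-cancel-≤ (≤-by _
  (0≤q-p bound 0≤+ 0≤2 0≤* 0≤q-p Q≤ 0≤+ 0≤2 0≤* (0≤κ 0≤* 0≤q-p L≤))
  (solve 9 (λ κ ρ C L N Q w k τ → con 2ℚ :* (κ :* (con 4ℚ :* τ) :+ ρ :* w :+ ρ :* k) :=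
      con 2ℚ :* (κ :* L :+ ρ :* N) :+
      ((con 2ℚ :* (Q :+ (con 0ℚ :* con 0ℚ :+ ρ :* w)) :+ con 2ℚ :* (con 0ℚ :+ ρ :* k)
        :- (con 4ℚ :* κ :* C :+ con 2ℚ :* (con 0ℚ :+ ρ :* N)))
       :+ con 2ℚ :* (con 4ℚ :* κ :* τ :- Q)
       :+ con 2ℚ :* (κ :* (con 2ℚ :* C :+ con 0ℚ :- L))))
    refl κ ρ C L N Q w k τ))

-- Unserved demand as a function of time.

after : ∀ {T} → (Fin T → ℚ) → ℕ → ℚ
after x τ = ∑ℚ λ t → if toℕ t ℕ.<ᵇ τ then 0ℚ else x t

<ᵇ-suc : ∀ a b → (a ℕ.<ᵇ suc b) ≡ (a ℕ.≤ᵇ b)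
<ᵇ-suc zero    b = refl
<ᵇ-suc (suc a) b = refl

<⇒<ᵇ : ∀ {a b} → a ℕ.< b → (a ℕ.<ᵇ b) ≡ true
<⇒<ᵇ {zero}  (s≤s _)   = refl
<⇒<ᵇ {suc a} (s≤s a<b) = <⇒<ᵇ a<b

upTo+after : ∀ {T} (x : Fin T → ℚ) t → ∑upTo t x + after x (time t) ≡ ∑ℚ x
upTo+after x t = trans
  (sym (∑-+ (λ t′ → if does (t′ Fin.≤? t) then x t′ else 0ℚ) (λ t′ →
      if toℕ t′ ℕ.<ᵇ time t then 0ℚ else x t′)))
  (∑-cong λ t′ → trans
    (cong (λ b → (if does (t′ Fin.≤? t) then x t′ else 0ℚ) + (if b then 0ℚ else x t′))
        (<ᵇ-suc (toℕ t′) (toℕ t)))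
    (both (does (t′ Fin.≤? t)) (x t′)))
  where
  both : ∀ b p → (if b then p else 0ℚ) + (if b then 0ℚ else p) ≡ p
  both true  p = ℚ.+-identityʳ p
  both false p = ℚ.+-identityˡ p

after-end : ∀ {T} (x : Fin T → ℚ) τ → T ℕ.≤ τ → after x τ ≡ 0ℚ
after-end {T} x τ T≤τ = trans
  (∑-cong λ t → cong (λ b → if b then 0ℚ else x t) (<⇒<ᵇ (ℕ.<-≤-trans (Fin.toℕ<n t) T≤τ))) (∑-zero T)

module _ {T : ℕ} (x : Fin T → ℚ) (0≤x : ∀ t → 0ℚ ≤ x t) where

  0≤after : ∀ τ → 0ℚ ≤ after x τ
  0≤after τ = ∑-nonNeg λ t → 0≤-unless (toℕ t ℕ.<ᵇ τ) (0≤x t)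
    where
    0≤-unless : ∀ b {p} → 0ℚ ≤ p → 0ℚ ≤ (if b then 0ℚ else p)
    0≤-unless true  _   = ℚ.≤-refl
    0≤-unless false 0≤p = 0≤p

  after-step : ∀ τ → after x (suc τ) ≤ after x τ
  after-step τ = ∑-mono λ t → cases (toℕ t) τ (0≤x t)
    where
    cases : ∀ a b {p} → 0ℚ ≤ p → (if a ℕ.<ᵇ suc b then 0ℚ else p) ≤ (if a ℕ.<ᵇ b then 0ℚ else p)
    cases zero    zero    0≤p = 0≤p
    cases zero    (suc b) _   = ℚ.≤-refl
    cases (suc a) zero    _   = ℚ.≤-refl
    cases (suc a) (suc b) 0≤p = cases a b 0≤p

prefix : (ℕ → ℚ) → ℕ → ℚ
prefix W zero    = 0ℚ
prefix W (suc m) = prefix W m + W m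

prefix-∑ : ∀ {n} (f : Fin n → ℕ → ℚ) m → prefix (λ τ → ∑ℚ λ j → f j τ) m ≡ ∑ℚ λ j → prefix (f j) m
prefix-∑ {n} f zero    = sym (∑-zero n)
prefix-∑ f (suc m) = trans (cong (_+ ∑ℚ (λ j → f j m)) (prefix-∑ f m))
    (sym (∑-+ (λ j → prefix (f j) m) (λ j → f j m)))

-- `x t` contributes to `after x τ` exactly when τ < `time t`, so it is counted min(m, `time t`)
-- times among the first `m` values.
prefix-after : ∀ {T} (x : Fin T → ℚ) m → prefix (after x) m ≡ ∑ℚ λ t → ℕ→ℚ (m ℕ.⊓ time t) * x t
prefix-after {T} x zero    = trans (sym (∑-zero T)) (∑-cong λ t → sym (ℚ.*-zeroˡ (x t)))
prefix-after x (suc m) = trans (cong (_+ after x m) (prefix-after x m))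
  (trans (sym (∑-+ (λ t → ℕ→ℚ (m ℕ.⊓ time t) * x t) (λ t → if toℕ t ℕ.<ᵇ m then 0ℚ else x t)))
    (∑-cong λ t → term (x t) (toℕ t ℕ.<ᵇ m) (m ℕ.⊓ time t) (m ℕ.⊓ toℕ t) (⊓-count m (toℕ t))))
  where
  ⊓-count : ∀ m t → m ℕ.⊓ suc t ℕ.+ (if t ℕ.<ᵇ m then 0 else 1) ≡ suc (m ℕ.⊓ t)
  ⊓-count zero    t       = refl
  ⊓-count (suc m) zero    = cong (λ k → suc k ℕ.+ 0) (ℕ.⊓-zeroʳ m)
  ⊓-count (suc m) (suc t) = cong suc (⊓-count m t)
  term : ∀ p b a c → a ℕ.+ (if b then 0 else 1) ≡ suc c → ℕ→ℚ a * p + (if b then 0ℚ else p) ≡ ℕ→ℚ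
      (suc c) * p
  term p true  a c eq = trans (ℚ.+-identityʳ (ℕ→ℚ a * p))
      (cong (λ k → ℕ→ℚ k * p) (trans (sym (ℕ.+-identityʳ a)) eq))
  term p false a c eq = trans (solve 2 (λ a p → a :* p :+ p := (a :+ con 1ℚ) :* p) refl (ℕ→ℚ a) p)
    (cong (_* p) (trans (sym (ℕ→ℚ-+ a 1)) (cong ℕ→ℚ eq)))

module _ (W : ℕ → ℚ) (W-step : ∀ τ → W (suc τ) ≤ W τ) where

  -- `W` is decreasing, so each of the `m` new terms is at least the last one.
  prefix-block : ∀ a m → prefix W (suc a) + ℕ→ℚ m * W (m ℕ.+ a) ≤ prefix W (suc (m ℕ.+ a))
  prefix-block a zero    = ℚ.≤-reflexive (solve 2 (λ p w → p :+ con 0ℚ :* w := p) refl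
      (prefix W (suc a)) (W a))
  prefix-block a (suc m) = ≤-by _ (0≤q-p (prefix-block a m) 0≤+ ℕ→ℚ-nonNeg m 0≤* 0≤q-p
      (W-step (m ℕ.+ a)))
    (trans
      (solve 5 (λ p k w w′ q → q :+ w′ := p :+ (con 1ℚ :+ k) :* w′ :+ ((q :- (p :+ k :* w)) :+ k
          :* (w :- w′)))
        refl (prefix W (suc a)) (ℕ→ℚ m) (W (m ℕ.+ a)) (W (suc m ℕ.+ a)) (prefix W (suc (m ℕ.+ a))))
      (cong (λ k → prefix W (suc a) + k * W (suc m ℕ.+ a) +
          ((prefix W (suc (m ℕ.+ a)) - (prefix W (suc a) + ℕ→ℚ m * W (m ℕ.+ a)))
              + ℕ→ℚ m * (W (m ℕ.+ a) - W (suc m ℕ.+ a))))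
        (sym (ℕ→ℚ-suc m))))

  prefix-double : ∀ τ → prefix W (suc τ) + ℕ→ℚ τ * W (2 ℕ.* τ) ≤ prefix W (suc (2 ℕ.* τ))
  prefix-double τ = subst (λ k → prefix W (suc τ) + ℕ→ℚ τ * W k ≤ prefix W (suc k))
    (cong (τ ℕ.+_) (sym (ℕ.+-identityʳ τ))) (prefix-block τ τ)

-- Averaging over the two sequences of times.

20ℚ : ℚ
20ℚ = ℕ→ℚ 20

module _ (W : ℕ → ℚ) (0≤W : ∀ τ → 0ℚ ≤ W τ) (W-step : ∀ τ → W (suc τ) ≤ W τ)
         (Z : ℚ) (prefix≤Z : ∀ m → prefix W m ≤ Z) where

  -- The times τ, 2τ, 4τ, … are shared between the two sequences, and
  -- τ W(2τ) is at most the sum of W over the τ times in (τ, 2τ].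
  doubling : ∀ k τ → tail-bound W k τ + tail-bound W k (2 ℕ.* τ) + 20ℚ * prefix W (suc τ) ≤
                        10ℚ * (ℕ→ℚ τ * W τ) + 20ℚ * Z
  doubling zero τ = ≤-by _
    (ℕ→ℚ-nonNeg 10 0≤* (ℕ→ℚ-nonNeg τ 0≤* 0≤W τ) 0≤+ ℕ→ℚ-nonNeg 20 0≤* 0≤q-p (prefix≤Z (suc τ)))
    (solve 3 (λ a p Z → a :+ con 20ℚ :* Z := con 0ℚ :+ con 0ℚ :+ con 20ℚ :* p
        :+ (a :+ con 20ℚ :* (Z :- p)))
      refl (10ℚ * (ℕ→ℚ τ * W τ)) (prefix W (suc τ)) Z)
  doubling (suc k) τ = combine (ℕ→ℚ τ) (W τ) (W τ₂) (W τ₄) (tail-bound W k τ₄)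
      (tail-bound W k (2 ℕ.* τ₄))
      (tail-bound W k (4 ℕ.* τ₂)) (prefix W (suc τ)) (prefix W (suc τ₂)) (prefix W (suc τ₄)) (ℕ→ℚ τ₂)
          (ℕ→ℚ τ₄)
      (ℕ→ℚ-* 2 τ) (ℕ→ℚ-* 4 τ) (cong (tail-bound W k) 4·2τ)
      (doubling k τ₄) (prefix-double W W-step τ)
      (subst (λ τ₄ → prefix W (suc τ₂) + ℕ→ℚ τ₂ * W τ₄ ≤ prefix W (suc τ₄)) (sym (ℕ.*-assoc 2 2 τ))
          (prefix-double W W-step τ₂))
    where
    τ₂ τ₄ : ℕ
    τ₂ = 2 ℕ.* τ
    τ₄ = 4 ℕ.* τ
    4·2τ : 4 ℕ.* τ₂ ≡ 2 ℕ.* τ₄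
    4·2τ = trans (sym (ℕ.*-assoc 4 2 τ)) (ℕ.*-assoc 2 4 τ)
    combine : ∀ t w w₂ w₄ B B₂ B₂′ p p₂ p₄ t₂ t₄ → t₂ ≡ 2ℚ * t → t₄ ≡ 4ℚ * t → B₂′ ≡ B₂ →
      B + B₂ + 20ℚ * p₄ ≤ 10ℚ * (t₄ * w₄) + 20ℚ * Z →
      p + t * w₂ ≤ p₂ → p₂ + t₂ * w₄ ≤ p₄ →
      10ℚ * (t * w) + B + (10ℚ * (t₂ * w₂) + B₂′) + 20ℚ * p ≤ 10ℚ * (t * w) + 20ℚ * Z
    -- 10 · 2τ W(2τ) is 20 times what the block (τ, 2τ] pays for, and 10 · 4τ W(4τ) is 20 times what
    -- (2τ, 4τ] pays for.
    combine t w w₂ w₄ B B₂ _ p p₂ p₄ _ _ refl refl refl ih double double₂ = ≤-by _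
      (0≤q-p ih 0≤+ ℕ→ℚ-nonNeg 20 0≤* (0≤q-p double 0≤+ 0≤q-p double₂))
      (solve 10 (λ t w w₂ w₄ B B₂ p p₂ p₄ Z → con 10ℚ :* (t :* w) :+ con 20ℚ :* Z :=
          con 10ℚ :* (t :* w) :+ B :+ (con 10ℚ :* (con 2ℚ :* t :* w₂) :+ B₂) :+ con 20ℚ :* p :+
          ((con 10ℚ :* (con 4ℚ :* t :* w₄) :+ con 20ℚ :* Z :- (B :+ B₂ :+ con 20ℚ :* p₄)) :+
           con 20ℚ :* ((p₂ :- (p :+ t :* w₂)) :+ (p₄ :- (p₂ :+ con 2ℚ :* t :* w₄)))))
        refl t w w₂ w₄ B B₂ p p₂ p₄ Z)

  -- The initial terms 2n and 4n are absorbed by the 20 W(0) contained in the prefix at τ = 1, since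
  -- W(0) ≥ n; the 14 is 20 - 6.
  average : ∀ k n V → 0ℚ ≤ n → n ≤ W 0 → V ≤ 2ℚ * (ℕ→ℚ 1 * n) + tail-bound W k 1 →
            V ≤ 2ℚ * (ℕ→ℚ 2 * n) + tail-bound W k 2 → V ≤ 10ℚ * Z
  average k n V 0≤n n≤W₀ V≤ V≤′ = 2*-cancel-≤ (≤-by _
    (0≤q-p (doubling k 1) 0≤+ 0≤q-p V≤ 0≤+ 0≤q-p V≤′ 0≤+ ℕ→ℚ-nonNeg 20 0≤* 0≤q-p n≤W₀ 0≤+
      ℕ→ℚ-nonNeg 10 0≤* 0≤W 1 0≤+ ℕ→ℚ-nonNeg 14 0≤* 0≤n)
    (solve 7 (λ n V W₀ W₁ B B₂ Z → con 2ℚ :* (con 10ℚ :* Z) := con 2ℚ :* V :+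
        ((con 10ℚ :* (con (ℕ→ℚ 1) :* W₁) :+ con 20ℚ :* Z :- (B :+ B₂ :+ con 20ℚ :* (con 0ℚ :+ W₀ :+ W₁)))
         :+ (con 2ℚ :* (con (ℕ→ℚ 1) :* n) :+ B :- V) :+ (con 2ℚ :* (con (ℕ→ℚ 2) :* n) :+ B₂ :- V)
         :+ con 20ℚ :* (W₀ :- n) :+ con 10ℚ :* W₁ :+ con (ℕ→ℚ 14) :* n))
      refl n V (W 0) (W 1) (tail-bound W k 1) (tail-bound W k 2) Z))

-- Rounding a feasible point of the linear program.

last-≥ : ∀ k τ → 1 ℕ.≤ τ → k ℕ.+ τ ℕ.≤ last k τ
last-≥ zero    τ _   = ℕ.≤-refl
last-≥ (suc k) τ 1≤τ = ℕ.≤-trans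
  (ℕ.≤-trans (ℕ.≤-reflexive (sym (ℕ.+-suc k τ))) (ℕ.+-monoʳ-≤ k (ℕ.+-mono-≤ 1≤τ (ℕ.m≤m+n τ (2 ℕ.* τ)))))
  (last-≥ k (4 ℕ.* τ) (ℕ.≤-trans 1≤τ (ℕ.m≤n*m τ 4)))

-- Without any time, covering a node would mean 1 ≤ 0.
horizon : ∀ {n T} (x : Fin n → Fin T → ℚ) → (∀ j → 1ℚ ≤ ∑ℚ (x j)) → n ≡ 0 ⊎ 1 ℕ.≤ T
horizon {zero}          x covered = inj₁ refl
horizon {suc n} {zero}  x covered = contradiction (covered zero) λ where (*≤* (ℤ.+≤+ ()))
horizon {suc n} {suc T} x covered = inj₂ (s≤s z≤n)

-- Tours are needed for times beyond `T`, where there is no `z`. The one for `T` serves, as no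
-- demand is left after it.
latest : ∀ {T} τ → 1 ℕ.≤ τ → 1 ℕ.≤ T → ∃[ t ] time {T} t ℕ.≤ τ × (∀ (x : Fin T → ℚ) →
    after x (time t) ≡ after x τ)
latest {suc T} (suc τ) _ _ = choose (suc τ ℕ.≤? suc T)
  where
  choose : Dec (suc τ ℕ.≤ suc T) → _
  choose (yes τ<T) = fromℕ< τ<T , ℕ.≤-reflexive t≡τ , λ x → cong (after x) t≡τ
    where
    t≡τ : time (fromℕ< τ<T) ≡ suc τ
    t≡τ = cong suc (Fin.toℕ-fromℕ< τ<T)
  choose (no τ≮T) = fromℕ T , ℕ.≤-trans (ℕ.≤-reflexive t≡T) T≤τ , λ x →
    trans (after-end x (time (fromℕ T)) (ℕ.≤-reflexive (sym t≡T))) (sym (after-end x (suc τ) T≤τ))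
    where
    t≡T : time (fromℕ T) ≡ suc T
    t≡T = cong suc (Fin.toℕ-fromℕ T)
    T≤τ : suc T ℕ.≤ suc τ
    T≤τ = ℕ.<⇒≤ (ℕ.≰⇒> τ≮T)

module Rounding {n : ℕ} (I : Instance n) {T : ℕ} (x : Fin n → Fin T → ℚ) (z : Edge n → Fin T → ℚ)
                (feasible : LP1Feasible I T x z) where
  open Instance I
  open IsMetric isMetric using (≈⇒0) renaming (sym to d-sym; triangle to d-triangle)
  open LP1Feasible feasible renaming (length to budget)

  dℚ : Node n → Node n → ℚ
  dℚ u v = ℕ→ℚ (d u v)

  0≤dℚ : ∀ u v → 0ℚ ≤ dℚ u v
  0≤dℚ u v = ℕ→ℚ-nonNeg (d u v)

  dℚ-sym : ∀ u v → dℚ u v ≡ dℚ v u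
  dℚ-sym u v = cong ℕ→ℚ (d-sym u v)

  dℚ-triangle : ∀ u v w → dℚ u w ≤ dℚ u v + dℚ v w
  dℚ-triangle u v w = ℚ.≤-trans (ℕ→ℚ-mono-≤ (d-triangle u v w)) (ℚ.≤-reflexive (ℕ→ℚ-+ (d u v) (d v w)))

  open Travel dℚ 0≤dℚ dℚ-sym dℚ-triangle
  open Concatenation dℚ 0≤dℚ dℚ-sym dℚ-triangle

  W : ℕ → ℚ
  W τ = ∑ℚ λ j → after (x j) τ

  Tour : ℕ → ℚ → ℚ → Set
  Tour τ κ ρ = ∃[ xs ] (∀ v → count v xs ℕ.≤ 1) × count zero xs ≡ 0 ×
    κ * pathLength zero xs zero + ρ * ℕ→ℚ n ≤ κ * (4ℚ * ℕ→ℚ τ) + ρ * W τ + ρ * ∣ xs ∣ₗ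

  module _ (t : Fin T) (κ ρ : ℚ) (0≤κ : 0ℚ ≤ κ) (0≤ρ : 0ℚ ≤ ρ) where

    private
      edges : ∃[ M ] Σ (Fin M → Edge n) λ edge → ∀ f → ∑Edge f ≡ ∑ℚ (f ∘ edge)
      edges = ∑-Σ toℕ

      M : ℕ
      M = proj₁ edges
      edge : Fin M → Edge n
      edge = proj₁ (proj₂ edges)
      ∑edge : ∀ f → ∑Edge f ≡ ∑ℚ (f ∘ edge)
      ∑edge = proj₂ (proj₂ edges)

      h l : Fin M → Node n
      h = hi ∘ edge
      l = lo ∘ edge
      z′ : Fin M → ℚ
      z′ e = z (edge e) t

    open PrizeCollecting {n} z′ (λ e → z-nonneg (edge e) t)

    inside : (Node n → Bool) → Subset n
    inside S = Vec.tabulate (S ∘ suc)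

    inside-lookup : ∀ S → S zero ≡ false → ∀ v → Vec.lookup (outside Vec.∷ inside S) v ≡ S v
    inside-lookup S S0 zero    = sym S0
    inside-lookup S S0 (suc j) = Vec.lookup∘tabulate (S ∘ suc) j

    left : Node n → ℚ
    left = fromRest λ j → after (x j) (time t)

    -- The coverage of `j` splits at `time t`: the earlier part is bounded by the cut constraint of
    -- the linear program, the later part is the slack.
    cut-left : ∀ S v → S zero ≡ false → S v ≡ true → 1ℚ ≤ cutWeight h l S + left v
    cut-left S zero    S0 Sv = contradiction (trans (sym S0) Sv) λ ()
    cut-left S (suc j) S0 Sv = begin
      1ℚ                                             ≤⟨ covered j ⟩
      ∑ℚ (x j)                                       ≡⟨ upTo+after (x j) t ⟨
      ∑upTo t (x j) + after (x j) (time t)           ≤⟨ ℚ.+-monoˡ-≤ (after (x j) (time t))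
          (cut t (inside S) j
                                                          (Vec.lookup⇒[]= j (inside S) (trans
                                                              (inside-lookup S S0 (suc j)) Sv))) ⟩
      ∑δ (inside S) (λ e → z e t) + after (x j) (time t)
        ≡⟨ cong (_+ after (x j) (time t)) (trans
             (∑edge λ e → if Vec.lookup (outside Vec.∷ inside S) (hi e) xor Vec.lookup
                 (outside Vec.∷ inside S) (lo e)
                          then z e t else 0ℚ)
             (∑-cong λ e → cong₂ (λ a b → if a xor b then z′ e else 0ℚ) (inside-lookup S S0 (h e))
                 (inside-lookup S S0 (l e)))) ⟩
      cutWeight h l S + left (suc j) ∎
      where open ℚ.≤-Reasoning

    problem : Problem
    problem = record
      { h = h ; l = l ; c = λ e → 4ℚ * κ * dℚ (h e) (l e) ; π = fromRest (λ _ → ρ) ; s = left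
      ; 0≤c = λ e → ℕ→ℚ-nonNeg 4 0≤* 0≤κ 0≤* 0≤dℚ (h e) (l e)
      ; 0≤π = λ { zero → ℚ.≤-refl ; (suc _) → 0≤ρ }
      ; 0≤s = λ { zero → ℚ.≤-refl ; (suc j) → 0≤after (x j) (x-nonneg j) (time t) }
      ; cut = cut-left }

    ∑zc≤ : ∑ℚ (λ e → z′ e * (4ℚ * κ * dℚ (h e) (l e))) ≤ 4ℚ * κ * ℕ→ℚ (time t)
    ∑zc≤ = begin
      ∑ℚ (λ e → z′ e * (4ℚ * κ * dℚ (h e) (l e)))
        ≡⟨ ∑-cong (λ e → solve 3 (λ z k d → z :* (k :* d) := k :* (d :* z)) refl
            (z′ e) (4ℚ * κ) (dℚ (h e) (l e))) ⟩
      ∑ℚ (λ e → 4ℚ * κ * (dℚ (h e) (l e) * z′ e))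
        ≡⟨ ∑-*ˡ (4ℚ * κ) (λ e → dℚ (h e) (l e) * z′ e) ⟩
      4ℚ * κ * ∑ℚ (λ e → dℚ (h e) (l e) * z′ e)
        ≡⟨ cong (4ℚ * κ *_) (∑edge λ e → dℚ (hi e) (lo e) * z e t) ⟨
      4ℚ * κ * ∑Edge (λ e → dℚ (hi e) (lo e) * z e t)
        ≤⟨ ℚ.*-monoˡ-≤-nonNeg (4ℚ * κ) {{nonNegative (ℕ→ℚ-nonNeg 4 0≤* 0≤κ)}} (budget t) ⟩
      4ℚ * κ * ℕ→ℚ (time t) ∎
      where open ℚ.≤-Reasoning

    tour-at : Tour (time t) κ ρ
    tour-at = tour-of (solvable problem)
      where
      tour-of : Solution problem → Tour (time t) κ ρ
      tour-of (f , hangs , _ , occ , bound) = preorder f ,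
        (λ v → ℕ.≤-trans (ℕ.≤-reflexive (count-preorder v f)) (occ v)) ,
        trans (count-preorder zero f) (occurs-root f hangs) ,
        doubled-tree κ ρ C (pathLength zero (preorder f) zero) (ℕ→ℚ n)
          (∑ℚ (λ e → z′ e * (4ℚ * κ * dℚ (h e) (l e)))) (W (time t)) (∣ preorder f ∣ₗ) (ℕ→ℚ (time t))
          0≤κ L≤ ∑zc≤ bound′
        where
        C : ℚ
        C = cost (λ e → dℚ (h e) (l e)) f
        L≤ : pathLength zero (preorder f) zero ≤ 2ℚ * C + 0ℚ
        L≤ = subst₂ (λ xs D → pathLength zero xs zero ≤ 2ℚ * C + D)
          (List.++-identityʳ (preorder f)) (cong ℕ→ℚ (≈⇒0 refl))
          (pathLength-preorder h l zero f [] zero hangs)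
        bound′ : 4ℚ * κ * C + 2ℚ * (0ℚ + ρ * ℕ→ℚ n) ≤
          2ℚ * (∑ℚ (λ e → z′ e * (4ℚ * κ * dℚ (h e) (l e))) + (0ℚ * 0ℚ + ρ * W (time t))) +
          2ℚ * (0ℚ + ρ * ∣ preorder f ∣ₗ)
        bound′ = subst₂ _≤_
          (cong₂ (λ a b → a + 2ℚ * (0ℚ + b)) (cost-* (4ℚ * κ) (λ e → dℚ (h e) (l e)) f) (∑-const n ρ))
          (cong₂ (λ a b → 2ℚ * (∑ℚ (λ e → z′ e * (4ℚ * κ * dℚ (h e) (l e))) + (0ℚ * 0ℚ + a))
              + 2ℚ * (0ℚ + b))
            (∑-*ˡ ρ (λ j → after (x j) (time t))) (weight-const {h = h} {l} zero ρ f hangs))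
          bound

  tour : ∀ τ → 1 ℕ.≤ τ → ∀ κ ρ → 0ℚ ≤ κ → 0ℚ ≤ ρ → Tour τ κ ρ
  tour τ 1≤τ κ ρ 0≤κ 0≤ρ = [ stay , (λ 1≤T → relax (latest τ 1≤τ 1≤T)) ]′ (horizon x covered)
    where
    0≤W′ : 0ℚ ≤ W τ
    0≤W′ = ∑-nonNeg λ j → 0≤after (x j) (x-nonneg j) τ
    stay : n ≡ 0 → Tour τ κ ρ
    stay n≡0 = [] , (λ _ → z≤n) , refl ,
      subst₂ (λ D k → κ * D + ρ * k ≤ κ * (4ℚ * ℕ→ℚ τ) + ρ * W τ + ρ * 0ℚ) (cong ℕ→ℚ (sym (≈⇒0 refl)))
          (cong ℕ→ℚ (sym n≡0))
        (≤-by _ (0≤κ 0≤* (ℕ→ℚ-nonNeg 4 0≤* ℕ→ℚ-nonNeg τ) 0≤+ 0≤ρ 0≤* 0≤W′)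
          (solve 4 (λ κ ρ c w → κ :* c :+ ρ :* w :+ ρ :* con 0ℚ := κ :* con 0ℚ :+ ρ :* con 0ℚ
              :+ (κ :* c :+ ρ :* w))
            refl κ ρ (4ℚ * ℕ→ℚ τ) (W τ)))
    relax : ∃[ t ] time {T} t ℕ.≤ τ × (∀ (x : Fin T → ℚ) → after x (time t) ≡ after x τ) → Tour τ κ ρ
    relax (t , t≤τ , after≡) = map₂ (λ {xs} → map₂ (map₂ λ bound → ℚ.≤-trans bound
        (ℚ.+-monoˡ-≤ (ρ * ∣ xs ∣ₗ) (ℚ.+-mono-≤ longer
            (ℚ.≤-reflexive (cong (ρ *_) (∑-cong λ j → after≡ (x j))))))))
      (tour-at t κ ρ 0≤κ 0≤ρ)
      where
      longer : κ * (4ℚ * ℕ→ℚ (time t)) ≤ κ * (4ℚ * ℕ→ℚ τ)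
      longer = ≤-by _ (0≤κ 0≤* (ℕ→ℚ-nonNeg 4 0≤* 0≤q-p (ℕ→ℚ-mono-≤ t≤τ)))
        (solve 3 (λ κ t τ → κ :* (con 4ℚ :* τ) := κ :* (con 4ℚ :* t) :+ κ :* (con 4ℚ :* (τ :- t)))
          refl κ (ℕ→ℚ (time t)) (ℕ→ℚ τ))

  0≤W : ∀ τ → 0ℚ ≤ W τ
  0≤W τ = ∑-nonNeg λ j → 0≤after (x j) (x-nonneg j) τ

  W-step : ∀ τ → W (suc τ) ≤ W τ
  W-step τ = ∑-mono λ j → after-step (x j) (x-nonneg j) τ

  W-end : ∀ τ → T ℕ.≤ τ → W τ ≡ 0ℚ
  W-end τ T≤τ = trans (∑-cong λ j → after-end (x j) τ T≤τ) (∑-zero n)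

  n≤W₀ : ℕ→ℚ n ≤ W 0
  n≤W₀ = subst (_≤ W 0) (trans (∑-const n 1ℚ) (ℚ.*-identityˡ (ℕ→ℚ n))) (∑-mono covered)

  prefix≤objective : ∀ m → prefix W m ≤ LP1Objective x
  prefix≤objective m = begin
    prefix W m                                          ≡⟨ prefix-∑ (λ j → after (x j)) m ⟩
    ∑ℚ (λ j → prefix (after (x j)) m)                   ≡⟨ ∑-cong (λ j → prefix-after (x j) m) ⟩
    ∑ℚ (λ j → ∑ℚ λ t → ℕ→ℚ (m ℕ.⊓ time t) * x j t)      ≤⟨ ∑-mono (λ j → ∑-mono λ t → at-most j t) ⟩
    LP1Objective x                                      ∎
    where
    open ℚ.≤-Reasoning
    at-most : ∀ j t → ℕ→ℚ (m ℕ.⊓ time t) * x j t ≤ ℕ→ℚ (time t) * x j t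
    at-most j t = ℚ.*-monoʳ-≤-nonNeg (x j t) {{nonNegative (x-nonneg j t)}}
        (ℕ→ℚ-mono-≤ (ℕ.m⊓n≤n m (time t)))

  path-from : ∀ P → IsOptimalPath I P → ∀ τ → 1 ℕ.≤ τ →
              ℕ→ℚ (totalLatency I P) ≤ 2ℚ * (ℕ→ℚ τ * ℕ→ℚ n) + tail-bound W T τ
  path-from P optimal τ 1≤τ = compare (concatenate W 0≤W tour T τ 1≤τ
      (W-end (last T τ) (ℕ.≤-trans (ℕ.m≤m+n T τ) (last-≥ T τ 1≤τ))) nonRoot refl)
    where
    compare : _ → _
    compare (ws , enum , ws≤) = ℚ.≤-trans (ℕ→ℚ-mono-≤ (optimal (listPath ws enum)))
      (ℚ.≤-trans (ℚ.≤-reflexive (totalLatency-listPath I 0≤dℚ dℚ-sym dℚ-triangle ws enum))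
        (subst (λ k → waiting zero ws ≤ 2ℚ * (ℕ→ℚ τ * ℕ→ℚ k) + tail-bound W T τ) (#-nonRoot n) ws≤))

  optimum≤10·objective : ∀ P → IsOptimalPath I P → ℕ→ℚ (totalLatency I P) ≤ 10ℚ * LP1Objective x
  optimum≤10·objective P optimal = average W 0≤W W-step (LP1Objective x) prefix≤objective T (ℕ→ℚ n)
    (ℕ→ℚ (totalLatency I P)) (ℕ→ℚ-nonNeg n) n≤W₀
    (path-from P optimal 1 (s≤s z≤n)) (path-from P optimal 2 (s≤s z≤n))

open import Data.Integer.Base using (+_)

theorem3p1 : ∀ {n} (I : Instance n) (P : Path n) → IsOptimalPath I P →
    (T : ℕ) → (∀ j → latency I P j ℕ.≤ T) →
    (x : Fin n → Fin T → ℚ) (z : Edge n → Fin T → ℚ) → LP1Feasible I T x z →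
    ℕ→ℚ (totalLatency I P) ≤ (+ 1078 / 100) * LP1Objective x
theorem3p1 I P optimal T _ x z feasible = ℚ.≤-trans (optimum≤10·objective P optimal)
  -- The empty prefix is 0, so it shows the objective to be nonnegative; 10 ≤ 10.78 is decided by
  -- computation.
  (ℚ.*-monoʳ-≤-nonNeg (LP1Objective x) {{nonNegative (prefix≤objective 0)}}
      (ℚ.≤ᵇ⇒≤ {10ℚ} {+ 1078 / 100} tt))
  where open Rounding I x z feasible
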